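{- With \begin{align*} d_3^+&=0.854187179928304211983581540152668, & d_3^-&=-0.708415898743967960305146324178773,\\ d_4^+&=1.5834687793247475, & d_4^-&=-1.5060895457389591, \end{align*} we have \begin{align*} d_3^+-3\cdot10^{ -33}&\le \sup_n\delta_3(n)\le d_3^+, & d_3^-&\le\inf_n\delta_3(n)\le d_3^-+3\cdot10^{ -33},\\ d_4^+-6\cdot10^{ -16}&\le \sup_n\delta_4(n)\le d_4^+, & d_4^-&\le\inf_n\delta_4(n)\le d_4^-+6\cdot10^{ -16}. \end{align*} Consequently $\sup_n|\delta_3(n)|=\sup_n\delta_3(n)$ and $\sup_n|\delta_4(n)|=\sup_n\delta_4(n)$, and these satisfy the same bounds as $\sup_n\delta_3(n)$ and $\sup_n\delta_4(n)$ respectively.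
   Context: For $k\ge1$, $F_k:\mathbb{N}\to\mathbb{N}$ is defined by $F_k(0)=0$ and $F_k(n)=n-F_k^k(n-1)$ for $n\ge1$, where $F_k^k$ is the $k$-fold iterate of $F_k$. $\alpha_k$ is the unique positive real zero of $X^k+X-1$, and $\delta_k(n)=F_k(n)-\alpha_k n$; suprema and infima are over $n\in\mathbb{N}$. -}

module Defs where

open import Data.Nat as ℕ using (ℕ; zero; suc; _∸_; _≤ᵇ_)
open import Data.Bool using (if_then_else_)
open import Data.Integer using (+_)
open import Data.Rational using (ℚ; 0ℚ; 1ℚ; _+_; _-_; _*_; _/_; _≤_; _<_; -_)
open import Data.Product using (_×_)
open import Data.Sum using (_⊎_)

-- The nested recurrence F_k(0) = 0, F_k(n) = n - F_k^k(n-1).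

iter : ℕ → (ℕ → ℕ) → ℕ → ℕ
iter zero    f x = x
iter (suc j) f x = f (iter j f x)

-- Fupto k n agrees with F_k on {0,…,n} (values outside are irrelevant).
-- Well defined because F_k(m) ≤ m, so iterates of F_k on (n-1) stay ≤ n-1;
-- the truncated subtraction never truncates since F_k^k(n-1) ≤ n-1 < n.
Fupto : ℕ → ℕ → ℕ → ℕ
Fupto k zero    m = 0
Fupto k (suc n) m =
  if m ≤ᵇ n then Fupto k n m else (suc n ∸ iter k (Fupto k n) n)

F : ℕ → ℕ → ℕ
F k n = Fupto k n n

-- α_k, the unique positive root of X^k + X - 1, as a Dedekind cut on ℚ.

_^ℚ_ : ℚ → ℕ → ℚ
x ^ℚ zero  = 1ℚ
x ^ℚ suc j = x * (x ^ℚ j)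

P : ℕ → ℚ → ℚ
P k x = (x ^ℚ k) + x - 1ℚ

-- x ≤ α_k, x < α_k, α_k ≤ x, α_k < x  (P k is increasing on x > 0, P k 0 = -1)
x≤α : ℕ → ℚ → Set
x≤α k x = x ≤ 0ℚ ⊎ P k x ≤ 0ℚ

x<α : ℕ → ℚ → Set
x<α k x = x ≤ 0ℚ ⊎ P k x < 0ℚ

α≤x : ℕ → ℚ → Set
α≤x k x = 0ℚ < x × 0ℚ ≤ P k x

α<x : ℕ → ℚ → Set
α<x k x = 0ℚ < x × 0ℚ < P k x

ℕtoℚ : ℕ → ℚ
ℕtoℚ n = + n / 1

q≤αn : ℕ → ℕ → ℚ → Set
q≤αn k zero    q = q ≤ 0ℚ
q≤αn k (suc m) q = x≤α k (q * (+ 1 / suc m))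

q<αn : ℕ → ℕ → ℚ → Set
q<αn k zero    q = q < 0ℚ
q<αn k (suc m) q = x<α k (q * (+ 1 / suc m))

αn≤q : ℕ → ℕ → ℚ → Set
αn≤q k zero    q = 0ℚ ≤ q
αn≤q k (suc m) q = α≤x k (q * (+ 1 / suc m))

αn<q : ℕ → ℕ → ℚ → Set
αn<q k zero    q = 0ℚ < q
αn<q k (suc m) q = α<x k (q * (+ 1 / suc m))

-- δ_k(n) = F_k(n) - α_k n compared with a rational r.

δ≤ : ℕ → ℕ → ℚ → Set
δ≤ k n r = q≤αn k n (ℕtoℚ (F k n) - r)

δ< : ℕ → ℕ → ℚ → Set
δ< k n r = q<αn k n (ℕtoℚ (F k n) - r)

δ≥ : ℕ → ℕ → ℚ → Set
δ≥ k n r = αn≤q k n (ℕtoℚ (F k n) - r)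

δ> : ℕ → ℕ → ℚ → Set
δ> k n r = αn<q k n (ℕtoℚ (F k n) - r)

|δ|≤ : ℕ → ℕ → ℚ → Set
|δ|≤ k n r = δ≤ k n r × δ≥ k n (- r)

|δ|> : ℕ → ℕ → ℚ → Set
|δ|> k n r = δ> k n r ⊎ δ< k n (- r)

SupLe : (ℕ → ℚ → Set) → ℚ → Set
SupLe le b = ∀ n → le n b

SupGe : (ℕ → ℚ → Set) → ℚ → Set
SupGe gt b = ∀ (η : ℚ) → 0ℚ < η → Data.Product.∃ λ n → gt n (b - η)
  where import Data.Product

InfGe : (ℕ → ℚ → Set) → ℚ → Set
InfGe ge b = ∀ n → ge n b

InfLe : (ℕ → ℚ → Set) → ℚ → Set
InfLe lt b = ∀ (η : ℚ) → 0ℚ < η → Data.Product.∃ λ n → lt n (b + η)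
  where import Data.Product

-- sup_n |δ_k(n)| = sup_n δ_k(n) : both have the same rational upper bounds
-- (and both are ≥ their common lower bound, via the SupGe clauses below)
SameSup : ℕ → Set
SameSup k = ∀ (r : ℚ) → (SupLe (δ≤ k) r → SupLe (|δ|≤ k) r)
                      × (SupLe (|δ|≤ k) r → SupLe (δ≤ k) r)

d3⁺ d3⁻ ε3 d4⁺ d4⁻ ε4 : ℚ
d3⁺ = + 854187179928304211983581540152668 / 1000000000000000000000000000000000
d3⁻ = - (+ 708415898743967960305146324178773 / 1000000000000000000000000000000000)
ε3  = + 3 / 1000000000000000000000000000000000
d4⁺ = + 15834687793247475 / 10000000000000000
d4⁻ = - (+ 15060895457389591 / 10000000000000000)
ε4  = + 6 / 10000000000000000

{-# OPTIONS --safe #-}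

-- Put B 0 = ... = B (k-1) = 1 and B (k+i) = B (k-1+i) + B i. Since F_k (B (k+i) + m) =
-- B (k-1+i) + F_k m for m ≤ B (i+1), the deviation δ_k is additive along the greedy
-- decomposition in B, so its maximum over n < B j obeys a one-line dynamic program.
-- To stay within the integers α_k is replaced by B M / B (M+1): the scaled deviation
-- F_k(n) B (M+1) - n B M satisfies the recurrence of B in M, whose coefficients are positive,
-- so an inequality that holds for k consecutive M holds for all larger M.
-- The digits from some large J on are controlled by the exponential decay of the minors
-- B i B (M+1) - B (i+1) B M relative to B M; the digits below J are handled by evaluating
-- the dynamic program, whose maximizer is also the n approaching the supremum.
module Submission where

open import Defs
open import Data.Bool using (Bool; true; false; T; _∧_; if_then_else_)
open import Data.Empty using (⊥-elim)
open import Data.Integer as ℤ using (ℤ; +_; -[1+_]; ∣_∣; +≤+; -≤+)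
import Data.Integer.Properties as ℤₚ
import Data.Integer.Tactic.RingSolver as ℤRing
open import Data.List using (List; []; _∷_; length)
open import Data.Nat as ℕ using (ℕ; zero; suc; _*_; _^_; _∸_; _≤_; _<_; _≤ᵇ_; z≤n; s≤s)
open import Data.Nat.Induction using (<-rec)
open import Data.Nat.Properties
import Data.Nat.Tactic.RingSolver as ℕRing
open import Data.Product using (∃; _×_; _,_; proj₁; proj₂)
open import Data.Rational as ℚ using (ℚ; 0ℚ; 1ℚ; toℚᵘ)
import Data.Rational.Properties as ℚₚ
open import Data.Rational.Unnormalised as ℚᵘ using (mkℚᵘ; _≃_; *≡*; *≤*)
import Data.Rational.Unnormalised.Properties as ℚᵘₚ
open import Data.Sum using (_⊎_; inj₁; inj₂)
open import Data.Unit using (tt)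
open import Data.Vec using (Vec; []; _∷_; head; last; tail; _∷ʳ_)
open import Function using (_∘_)
open import Level using (0ℓ)
open import Relation.Binary.Consequences using (dec⇒weaklyDec)
open import Relation.Binary.PropositionalEquality hiding (J)
open import Relation.Nullary using (¬_; yes; no)
open import Relation.Nullary.Decidable using (toWitness)
import Tactic.RingSolver as ℚRing
open import Tactic.RingSolver.Core.AlmostCommutativeRing using (AlmostCommutativeRing; fromCommutativeRing)

-- Why the minors decay: in `B i B (M+1) - B (i+1) B M` the square of the dominant root of X^k -
-- X^(k-1) - 1 cancels, so for `M` near `i` the minor grows no faster than products of two distinct
-- roots, whose moduli stay below 4/3. Dividing by a lower bound `g / h` for the dominant root gives
-- the ratio `s / u`, equal to 52/57 for k = 3 and 29/30 for k = 4. Both ratios are close to 1,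
-- which forces a large cutoff: only around J = 900 and J = 1300 has the reserve `H (s / u)^J`
-- fallen below one unit of the last decimal asked for. The numbers below `B J` then run to well
-- over a hundred digits, and neither `F` nor `B` can be evaluated by its definition there. Every
-- test therefore runs on tables that carry the terms of `B` and the values of `f` along.
-- Inequalities about the ratios `B M / B (M+1)` pass to α without any limit: if they hold for all
-- large M, the recurrence of `B` turns them into the sign of X^k + X - 1.

module _ where

  open import Data.Nat using (_+_)

  -- The numeration system

  T⇒≡ : ∀ {b} → T b → b ≡ true
  T⇒≡ {true} _ = refl

  ¬T⇒≡ : ∀ {b} → ¬ T b → b ≡ false
  ¬T⇒≡ {false} _ = refl
  ¬T⇒≡ {true} h = ⊥-elim (h tt)

  module F-Recurrence (k : ℕ) where

    Fupto-stable : ∀ n {m} → m ≤ n → Fupto k n m ≡ F k m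
    Fupto-stable zero z≤n = refl
    Fupto-stable (suc n) {m} m≤1+n with m≤n⇒m<n∨m≡n m≤1+n
    ... | inj₁ (s≤s m≤n) rewrite T⇒≡ (≤⇒≤ᵇ m≤n) = Fupto-stable n m≤n
    ... | inj₂ refl = refl

    F-suc : ∀ n → F k (suc n) ≡ suc n ∸ iter k (Fupto k n) n
    F-suc n rewrite ¬T⇒≡ (<-irrefl refl ∘ ≤ᵇ⇒≤ (suc n) n) = refl

    F≤ : ∀ n → F k n ≤ n
    F≤ zero = z≤n
    F≤ (suc n) = subst (_≤ suc n) (sym (F-suc n)) (m∸n≤m (suc n) (iter k (Fupto k n) n))

    iter-F≤ : ∀ j n → iter j (F k) n ≤ n
    iter-F≤ zero n = ≤-refl
    iter-F≤ (suc j) n = ≤-trans (F≤ _) (iter-F≤ j n)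

    iter-Fupto : ∀ j n → iter j (Fupto k n) n ≡ iter j (F k) n
    iter-Fupto zero n = refl
    iter-Fupto (suc j) n =
      trans (cong (Fupto k n) (iter-Fupto j n)) (Fupto-stable n (iter-F≤ j n))

    F-rec : ∀ n → F k (suc n) + iter k (F k) n ≡ suc n
    F-rec n = begin
      F k (suc n) + iter k (F k) n           ≡⟨ cong (_+ iter k (F k) n) (trans (F-suc n) (cong (suc n ∸_) (iter-Fupto k n))) ⟩
      suc n ∸ iter k (F k) n + iter k (F k) n  ≡⟨ m∸n+n≡m (m≤n⇒m≤1+n (iter-F≤ k n)) ⟩
      suc n                                  ∎
      where open ≡-Reasoning

  module Recurrence {k : ℕ} {f : ℕ → ℕ} (f-zero : f 0 ≡ 0) (f-rec : ∀ n → f (suc n) + iter k f n ≡ suc n) where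

    f≤ : ∀ n → f n ≤ n
    f≤ zero = ≤-reflexive f-zero
    f≤ (suc n) = m+n≤o⇒m≤o (f (suc n)) (≤-reflexive (f-rec n))

    iter-f≤ : ∀ j n → iter j f n ≤ n
    iter-f≤ zero n = ≤-refl
    iter-f≤ (suc j) n = ≤-trans (f≤ _) (iter-f≤ j n)

    Step : ℕ → ℕ → Set
    Step a b = b ≡ a ⊎ b ≡ suc a

    iter-step : ∀ j n → (∀ m → m < suc n → Step (f m) (f (suc m))) →
                Step (iter j f n) (iter j f (suc n))
    iter-step zero n _ = inj₂ refl
    iter-step (suc j) n step with iter-step j n step
    ... | inj₁ eq = inj₁ (cong f eq)
    ... | inj₂ eq rewrite eq = step (iter j f n) (s≤s (iter-f≤ j n))

    -- By the recurrence, the increment of `f` at `suc n` and that of its k-fold iterate at `n` add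
    -- up to 1, and iterating a function with increments 0 and 1 gives such a function again.
    f-step : ∀ n → Step (f n) (f (suc n))
    f-step = <-rec _ go
      where
      go : ∀ n → (∀ {m} → m < n → Step (f m) (f (suc m))) → Step (f n) (f (suc n))
      go zero _ rewrite f-zero with f 1 | f≤ 1
      ... | zero        | _ = inj₁ refl
      ... | suc zero    | _ = inj₂ refl
      ... | suc (suc _) | s≤s ()
      go (suc n) rec with iter-step k n (λ m → rec {m})
      ... | inj₁ eq = inj₂ (+-cancelʳ-≡ (iter k f n) _ _ (begin
        f (suc (suc n)) + iter k f n        ≡⟨ cong (λ e → f (suc (suc n)) + e) eq ⟨
        f (suc (suc n)) + iter k f (suc n)  ≡⟨ f-rec (suc n) ⟩
        suc (suc n)                         ≡⟨ cong suc (f-rec n) ⟨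
        suc (f (suc n)) + iter k f n        ∎))
        where open ≡-Reasoning
      ... | inj₂ eq = inj₁ (+-cancelʳ-≡ (suc (iter k f n)) _ _ (begin
        f (suc (suc n)) + suc (iter k f n)  ≡⟨ cong (λ e → f (suc (suc n)) + e) eq ⟨
        f (suc (suc n)) + iter k f (suc n)  ≡⟨ f-rec (suc n) ⟩
        suc (suc n)                         ≡⟨ cong suc (f-rec n) ⟨
        suc (f (suc n) + iter k f n)        ≡⟨ +-suc (f (suc n)) _ ⟨
        f (suc n) + suc (iter k f n)        ∎))
        where open ≡-Reasoning

    f-mono : ∀ {m n} → m ≤ n → f m ≤ f n
    f-mono {m} {n} m≤n = subst (λ x → f m ≤ f x) (m+[n∸m]≡n m≤n) (go (n ∸ m))
      where
      go : ∀ d → f m ≤ f (m + d)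
      go zero = ≤-reflexive (cong f (sym (+-identityʳ m)))
      go (suc d) rewrite +-suc m d with f-step (m + d)
      ... | inj₁ eq = ≤-trans (go d) (≤-reflexive (sym eq))
      ... | inj₂ eq = ≤-trans (m≤n⇒m≤1+n (go d)) (≤-reflexive (sym eq))

  -- B (k′ + p) is the paper's A_{k,p} (A_{k,0} = 1, A_{k,1} = 2), with k = suc k′; the k′ leading
  -- ones make the recurrence valid from the start.
  record Base (k′ : ℕ) : Set where
    private k = suc k′
    field
      B        : ℕ → ℕ
      B-init   : ∀ {i} → i ≤ k′ → B i ≡ 1
      B-rec    : ∀ i → B (k + i) ≡ B (k′ + i) + B i
      f        : ℕ → ℕ
      f-zero   : f 0 ≡ 0
      f-rec    : ∀ n → f (suc n) + iter k f n ≡ suc n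
      f-base   : ∀ {i m} → i < k′ → m ≤ 1 → f (B (k + i) + m) ≡ B (k′ + i) + f m
      f-base-k : f (B (k + k′)) ≡ B (k′ + k′)

  module Numeration {k′ : ℕ} (base : Base k′) where

    open Base base public
    k : ℕ
    k = suc k′
    open Recurrence {k} {f} f-zero f-rec public

    split : ∀ i → i ≤ k′ ⊎ ∃ λ l → i ≡ k + l
    split i with ≤-<-connex i k′
    ... | inj₁ i≤k′ = inj₁ i≤k′
    ... | inj₂ k≤i = inj₂ (i ∸ k , sym (m+[n∸m]≡n k≤i))

    -- Bounds that are linear in `B` pass from the indices `i` and `k′ + i` to `k + i`; all growth
    -- estimates below are instances.
    B-induction : (Q : ℕ → Set) → (∀ {i} → i ≤ k′ → Q i) →
                  (∀ i → Q i → Q (k′ + i) → Q (k + i)) → ∀ i → Q i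
    B-induction Q small big = <-rec _ go
      where
      go : ∀ i → (∀ {j} → j < i → Q j) → Q i
      go i rec with split i
      ... | inj₁ i≤k′ = small i≤k′
      ... | inj₂ (l , refl) = big l (rec (s≤s (m≤n+m l k′))) (rec ≤-refl)

    B>0 : ∀ i → 0 < B i
    B>0 = B-induction (λ i → 0 < B i) (λ i≤k′ → ≤-reflexive (sym (B-init i≤k′)))
      (λ i _ h → ≤-trans h (≤-trans (m≤m+n _ (B i)) (≤-reflexive (sym (B-rec i)))))

    B-step : ∀ i → B i ≤ B (suc i)
    B-step i with split (suc i)
    ... | inj₁ h = ≤-reflexive (trans (B-init (≤-trans (n≤1+n i) h)) (sym (B-init h)))
    ... | inj₂ (l , refl) = ≤-trans (m≤m+n _ (B l)) (≤-reflexive (sym (B-rec l)))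

    B-mono : ∀ {i j} → i ≤ j → B i ≤ B j
    B-mono {i} i≤j = subst (λ x → B i ≤ B x) (m+[n∸m]≡n i≤j) (go _)
      where
      go : ∀ d → B i ≤ B (i + d)
      go zero = ≤-reflexive (cong B (sym (+-identityʳ i)))
      go (suc d) rewrite +-suc i d = ≤-trans (go d) (B-step (i + d))

    B-strict : ∀ i → B i < B (k + i)
    B-strict i = begin-strict
      B i                 <⟨ +-mono-≤ (B>0 (k′ + i)) ≤-refl ⟩
      B (k′ + i) + B i    ≡⟨ B-rec i ⟨
      B (k + i)           ∎
      where open ≤-Reasoning

    +f-zero : ∀ a → a + f 0 ≡ a
    +f-zero a = trans (cong (λ e → a + e) f-zero) (+-identityʳ a)

    Additive : ℕ → Set
    Additive N = ∀ i m → m ≤ B (suc i) → B (k + i) + m ≡ N → f (B (k + i) + m) ≡ B (k′ + i) + f m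

    module _ {N : ℕ} (IH : ∀ {n} → n < N → Additive n) where

      -- Keeps the remainder small enough for additivity to apply again after the leading index has
      -- dropped by one.
      f-B≤ : ∀ l y → y ≤ B (suc l) → B (suc l) < N → f y ≤ B l
      f-B≤ l y y≤ <N with split (suc l)
      ... | inj₁ h = subst (f y ≤_) (sym (B-init (≤-trans (n≤1+n l) h)))
                       (≤-trans (f≤ y) (subst (y ≤_) (B-init h) y≤))
      ... | inj₂ (l′ , refl) = begin
        f y                    ≤⟨ f-mono y≤ ⟩
        f (B (k + l′))         ≡⟨ cong f (+-identityʳ _) ⟨
        f (B (k + l′) + 0)     ≡⟨ IH (subst (_< N) (sym (+-identityʳ _)) <N) l′ 0 z≤n refl ⟩
        B (k′ + l′) + f 0      ≡⟨ +f-zero _ ⟩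
        B (k′ + l′)            ∎
        where open ≤-Reasoning

      -- Each application of `f` lowers the leading index by one and, by `f-B≤`, the bound on the
      -- remainder with it, so the condition for additivity survives all `j` steps.
      iter-additive : ∀ j l m → m ≤ B (j + l) → B (k′ + (j + l)) + m < N →
        iter j f (B (k′ + (j + l)) + m) ≡ B (k′ + l) + iter j f m × iter j f m ≤ B l
      iter-additive zero l m m≤ _ = refl , m≤
      iter-additive (suc j) l m m≤ <N = eq , f-B≤ l y y≤ B<N
        where
        y = iter j f m
        x = iter j f (B (k′ + (j + suc l)) + m)
        prev : x ≡ B (k′ + suc l) + y × y ≤ B (suc l)
        prev = iter-additive j (suc l) m (subst (λ e → m ≤ B e) (sym (+-suc j l)) m≤)
                 (subst (λ e → B (k′ + e) + m < N) (sym (+-suc j l)) <N)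
        y≤ = proj₂ prev
        x≡ : x ≡ B (k + l) + y
        x≡ = trans (proj₁ prev) (cong (λ e → B e + y) (+-suc k′ l))
        x<N : B (k + l) + y < N
        x<N = subst (_< N) x≡ (≤-<-trans (iter-f≤ j _)
                (subst (λ e → B (k′ + e) + m < N) (sym (+-suc j l)) <N))
        B<N : B (suc l) < N
        B<N = ≤-<-trans (≤-trans (B-mono (s≤s (m≤n+m l k′))) (m≤m+n _ y)) x<N
        eq : iter (suc j) f (B (k′ + suc (j + l)) + m) ≡ B (k′ + l) + f y
        eq = trans (cong (λ e → f (iter j f (B (k′ + e) + m))) (sym (+-suc j l)))
               (trans (cong f x≡) (IH x<N l y y≤ refl))

    -- Strong induction on the number itself. For a positive remainder, compare the recurrence with
    -- and without the leading term: in the k-fold iterate the leading term drops from `B (k + i)`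
    -- to `B i`, and `B (k + i) = B (k′ + i) + B i` leaves exactly `B (k′ + i)` for `f`.
    additive : ∀ N → Additive N
    additive = <-rec _ go
      where
      go : ∀ N → (∀ {n} → n < N → Additive n) → Additive N
      go N IH i m m≤ refl with ≤-<-connex k′ i
      go N IH i m m≤ refl | inj₂ i<k′ = f-base i<k′ (subst (m ≤_) (B-init i<k′) m≤)
      go N IH i (suc m) m≤ refl | inj₁ k′≤i with i ∸ k′ | m+[n∸m]≡n k′≤i
      ... | l | refl = +-cancelʳ-≡ (B (k′ + l) + iter k f m) _ _ (begin
        f (B (k + i) + suc m) + (B (k′ + l) + iter k f m)
          ≡⟨ cong₂ _+_ (cong f (+-suc _ m)) (sym it) ⟩
        f (suc (B (k + i) + m)) + iter k f (B (k + i) + m)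
          ≡⟨ f-rec _ ⟩
        suc (B (k + i) + m)
          ≡⟨ +-suc _ m ⟨
        B (k + i) + suc m
          ≡⟨ cong₂ _+_ (B-rec i) (sym (f-rec m)) ⟩
        (B (k′ + i) + B (k′ + l)) + (f (suc m) + iter k f m)
          ≡⟨ exchange (B (k′ + i)) (B (k′ + l)) (f (suc m)) (iter k f m) ⟩
        (B (k′ + i) + f (suc m)) + (B (k′ + l) + iter k f m) ∎)
        where
        open ≡-Reasoning
        exchange : ∀ a b c d → (a + b) + (c + d) ≡ (a + c) + (b + d)
        exchange = ℕRing.solve-∀
        it : iter k f (B (k + i) + m) ≡ B (k′ + l) + iter k f m
        it = trans (cong (λ e → iter k f (B e + m)) (sym (+-suc k′ i)))
               (proj₁ (iter-additive IH k l m (≤-trans (n≤1+n m) m≤)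
                 (subst (λ e → B e + m < B (k + i) + suc m) (sym (+-suc k′ i)) (+-monoʳ-< (B (k + i)) ≤-refl))))
      go N IH i zero m≤ refl | inj₁ k′≤i with m≤n⇒m<n∨m≡n k′≤i
      -- Here `i = k′` is not of the form `k + l`, so there is no room to descend by `k` indices and
      -- the value comes from the base data.
      ... | inj₂ refl = trans (cong f (+-identityʳ _)) (trans f-base-k (sym (+f-zero _)))
      ... | inj₁ k≤i with i ∸ k | m+[n∸m]≡n k≤i
      ...   | l | refl with B (k + l) in eqB | B>0 (k + l)
      -- With remainder zero, the predecessor of `B (k + i)` is `B (k′ + i) + m` where
      -- `suc m = B i`. Its k-fold iterate is `B (k′ + l) + iter k f m`; as `B (k′ + l)` is
      -- `f (suc m)` by induction, the recurrence at `m` evaluates this to `suc m`.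
      ...     | suc m | s≤s _ = +-cancelʳ-≡ (suc m) _ _ (begin
        f (B (k + i) + 0) + suc m
          ≡⟨ cong₂ _+_ (cong f (trans (+-identityʳ _) B≡)) (sym it) ⟩
        f (suc (B (k′ + i) + m)) + iter k f (B (k′ + i) + m)
          ≡⟨ f-rec _ ⟩
        suc (B (k′ + i) + m)
          ≡⟨ +-suc _ m ⟨
        B (k′ + i) + suc m
          ≡⟨ cong (_+ suc m) (+f-zero _) ⟨
        (B (k′ + i) + f 0) + suc m ∎)
        where
        open ≡-Reasoning
        B≡ : B (k + i) ≡ suc (B (k′ + i) + m)
        B≡ = trans (B-rec i) (trans (cong (λ e → B (k′ + i) + e) eqB) (+-suc _ m))
        i<N : B (k + l) + 0 < B (k + i) + 0
        i<N = +-monoˡ-< 0 (B-strict (k + l))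
        fB : f (suc m) ≡ B (k′ + l)
        fB = trans (cong f (trans (sym eqB) (sym (+-identityʳ _))))
               (trans (IH i<N l 0 z≤n refl) (+f-zero _))
        it : iter k f (B (k′ + i) + m) ≡ suc m
        it = begin
          iter k f (B (k′ + i) + m)
            ≡⟨ proj₁ (iter-additive IH k l m (≤-trans (n≤1+n m) (≤-reflexive (sym eqB)))
                 (≤-reflexive (sym (trans (+-identityʳ _) B≡)))) ⟩
          B (k′ + l) + iter k f m    ≡⟨ cong (_+ iter k f m) fB ⟨
          f (suc m) + iter k f m     ≡⟨ f-rec m ⟩
          suc m                      ∎

    f-additive : ∀ i {m} → m ≤ B (suc i) → f (B (k + i) + m) ≡ B (k′ + i) + f m
    f-additive i m≤ = additive _ i _ m≤ refl

  -- Decay of the minors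

  decide-≤ : ∀ {m n} → (m ≤ᵇ n) ≡ true → m ≤ n
  decide-≤ {m} {n} eq = ≤ᵇ⇒≤ m n (subst T (sym eq) tt)

  combination : List ℤ → (ℕ → ℤ) → ℕ → ℤ
  combination [] x i = + 0
  combination (c ∷ cs) x i = c ℤ.* x i ℤ.+ combination cs x (suc i)

  -- Σ_l |c_l| p^l q^(N-l)
  weight : List ℤ → (p q N : ℕ) → ℕ
  weight [] p q N = 0
  weight (c ∷ cs) p q N = ∣ c ∣ * q ^ N + p * weight cs p q (N ∸ 1)

  -- Cauchy's root bound: with r = p / q, the condition on `weight` reads Σ |c_l| r^l ≤ r^N, so the
  -- powers of r form a majorant that the recurrence preserves.
  geometric-decay : ∀ {p q} (x : ℕ → ℤ) cs N → length cs ≤ N →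
    (∀ i → x (N + i) ≡ combination cs x i) → weight cs p q N ≤ p ^ N →
    (∀ {i} → i < N → ∣ x i ∣ * q ^ i ≤ p ^ i) → ∀ i → ∣ x i ∣ * q ^ i ≤ p ^ i
  geometric-decay {p} {q} x cs N len step small init = <-rec _ go
    where
    open ≤-Reasoning
    combination-bound : ∀ cs N i → length cs ≤ N → (∀ {j} → j < N + i → ∣ x j ∣ * q ^ j ≤ p ^ j) →
                        ∣ combination cs x i ∣ * q ^ (N + i) ≤ p ^ i * weight cs p q N
    combination-bound [] N i _ _ = z≤n
    combination-bound (c ∷ cs) (suc N) i (s≤s len) h = begin
      ∣ c ℤ.* x i ℤ.+ r ∣ * (q * q ^ (N + i))
        ≤⟨ *-monoˡ-≤ _ (ℤₚ.∣i+j∣≤∣i∣+∣j∣ (c ℤ.* x i) r) ⟩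
      (∣ c ℤ.* x i ∣ + ∣ r ∣) * (q * q ^ (N + i))
        ≡⟨ cong₂ (λ d e → (d + ∣ r ∣) * (q * e)) (ℤₚ.abs-* c (x i)) (^-distribˡ-+-* q N i) ⟩
      (∣ c ∣ * ∣ x i ∣ + ∣ r ∣) * (q * (q ^ N * q ^ i))
        ≡⟨ expand (∣ c ∣) (∣ x i ∣) (∣ r ∣) q (q ^ N) (q ^ i) ⟩
      ∣ c ∣ * (q * q ^ N) * (∣ x i ∣ * q ^ i) + ∣ r ∣ * (q ^ N * (q * q ^ i))
        ≡⟨ cong (λ e → ∣ c ∣ * (q * q ^ N) * (∣ x i ∣ * q ^ i) + ∣ r ∣ * e) (^-distribˡ-+-* q N (suc i)) ⟨
      ∣ c ∣ * (q * q ^ N) * (∣ x i ∣ * q ^ i) + ∣ r ∣ * q ^ (N + suc i)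
        ≤⟨ +-mono-≤ (*-monoʳ-≤ (∣ c ∣ * (q * q ^ N)) (h (s≤s (m≤n+m i N))))
             (combination-bound cs N (suc i) len (λ {j} j< → h (subst (j <_) (+-suc N i) j<))) ⟩
      ∣ c ∣ * (q * q ^ N) * p ^ i + p * p ^ i * weight cs p q N
        ≡⟨ collect (∣ c ∣) (q * q ^ N) (p ^ i) p (weight cs p q N) ⟩
      p ^ i * (∣ c ∣ * (q * q ^ N) + p * weight cs p q N) ∎
      where
      r = combination cs x (suc i)
      expand : ∀ c v d q r t → (c * v + d) * (q * (r * t)) ≡ c * (q * r) * (v * t) + d * (r * (q * t))
      expand = ℕRing.solve-∀
      collect : ∀ c r t p w → c * r * t + p * t * w ≡ t * (c * r + p * w)
      collect = ℕRing.solve-∀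
    go : ∀ i → (∀ {j} → j < i → ∣ x j ∣ * q ^ j ≤ p ^ j) → ∣ x i ∣ * q ^ i ≤ p ^ i
    go i rec with ≤-<-connex N i
    ... | inj₂ i<N = init i<N
    ... | inj₁ N≤i with i ∸ N | m+[n∸m]≡n N≤i
    ...   | l | refl = begin
      ∣ x (N + l) ∣ * q ^ (N + l)               ≡⟨ cong (λ e → ∣ e ∣ * q ^ (N + l)) (step l) ⟩
      ∣ combination cs x l ∣ * q ^ (N + l)      ≤⟨ combination-bound cs N l len rec ⟩
      p ^ l * weight cs p q N                   ≤⟨ *-monoʳ-≤ (p ^ l) small ⟩
      p ^ l * p ^ N                             ≡⟨ *-comm (p ^ l) (p ^ N) ⟩
      p ^ N * p ^ l                             ≡⟨ ^-distribˡ-+-* p N l ⟨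
      p ^ (N + l)                               ∎

  ^-distribʳ-* : ∀ m n i → (m * n) ^ i ≡ m ^ i * n ^ i
  ^-distribʳ-* m n zero = refl
  ^-distribʳ-* m n (suc i) = trans (cong (m * n *_) (^-distribʳ-* m n i)) (swap m n (m ^ i) (n ^ i))
    where
    swap : ∀ a b c d → a * b * (c * d) ≡ a * c * (b * d)
    swap = ℕRing.solve-∀

  -- For `i = k′ + l` this is the scaled deviation of the single digit `B (k + l)`, which `f` maps
  -- to `B (k′ + l)`.
  minor : (ℕ → ℕ) → ℕ → ℕ → ℤ
  minor B i M = + B i ℤ.* + B (suc M) ℤ.- + B (suc i) ℤ.* + B M

  -- `p / q` is a growth rate for the minors near the diagonal. `growth` says that X^k - X^k′ - 1 is
  -- at most 0 at `g / h`, so that `g / h` is a lower growth rate for `B`.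
  record Decay {k′ : ℕ} (base : Base k′) : Set where
    open Base base using (B)
    field
      p q K₁    : ℕ
      minor-near : ∀ i {t} → t ≤ k′ → ∣ minor B i (i + t) ∣ * q ^ i ≤ K₁ * p ^ i
      g h K₂    : ℕ
      growth    : g ^ suc k′ ≤ h * g ^ k′ + h ^ suc k′
      growth-init : ∀ {i} → i ≤ k′ → g ^ i ≤ K₂ * h ^ i

  module DecayProperties {k′ : ℕ} {base : Base k′} (decay : Decay base) where

    open Numeration base
    open Decay decay public

    u s K : ℕ
    u = q * g
    s = p * h
    K = K₁ * K₂

    D : ℕ → ℕ → ℤ
    D = minor B

    b : ℕ → ℤ
    b i = + B i

    b-rec : ∀ i → b (k + i) ≡ b (k′ + i) ℤ.+ b i
    b-rec i = cong +_ (B-rec i)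

    b-rec-suc : ∀ i → b (suc (k + i)) ≡ b (suc (k′ + i)) ℤ.+ b (suc i)
    b-rec-suc i = trans (cong b (sym (+-suc k i)))
      (trans (b-rec (suc i)) (cong (λ e → b e ℤ.+ b (suc i)) (+-suc k′ i)))

    D-rec : ∀ i M → D i (k + M) ≡ D i (k′ + M) ℤ.+ D i M
    D-rec i M = trans (cong₂ (λ x y → b i ℤ.* x ℤ.- b (suc i) ℤ.* y) (b-rec-suc M) (b-rec M))
      (distrib (b i) (b (suc i)) (b (suc (k′ + M))) (b (suc M)) (b (k′ + M)) (b M))
      where
      distrib : ∀ x y z z′ w w′ → x ℤ.* (z ℤ.+ z′) ℤ.- y ℤ.* (w ℤ.+ w′)
                ≡ (x ℤ.* z ℤ.- y ℤ.* w) ℤ.+ (x ℤ.* z′ ℤ.- y ℤ.* w′)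
      distrib = ℤRing.solve-∀

    left-comm : ∀ i j t → i + (j + t) ≡ j + (i + t)
    left-comm = ℕRing.solve-∀

    -- In its second index a minor satisfies the recurrence of `B`, whose coefficients are positive;
    -- the bounds at the first `k` distances therefore propagate with `B t` as majorant.
    minor-bound : ∀ i t → ∣ D i (i + t) ∣ * q ^ i ≤ K₁ * p ^ i * B t
    minor-bound i = B-induction _ near far
      where
      near : ∀ {t} → t ≤ k′ → ∣ D i (i + t) ∣ * q ^ i ≤ K₁ * p ^ i * B t
      near {t} t≤k′ rewrite B-init t≤k′ | *-identityʳ (K₁ * p ^ i) = minor-near i t≤k′
      far : ∀ t → ∣ D i (i + t) ∣ * q ^ i ≤ K₁ * p ^ i * B t →
            ∣ D i (i + (k′ + t)) ∣ * q ^ i ≤ K₁ * p ^ i * B (k′ + t) →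
            ∣ D i (i + (k + t)) ∣ * q ^ i ≤ K₁ * p ^ i * B (k + t)
      far t h₁ h₂ = begin
        ∣ D i (i + (k + t)) ∣ * q ^ i
          ≡⟨ cong (λ e → ∣ D i e ∣ * q ^ i) (left-comm i k t) ⟩
        ∣ D i (k + (i + t)) ∣ * q ^ i
          ≡⟨ cong (λ e → ∣ e ∣ * q ^ i) (D-rec i (i + t)) ⟩
        ∣ D i (k′ + (i + t)) ℤ.+ D i (i + t) ∣ * q ^ i
          ≤⟨ *-monoˡ-≤ (q ^ i) (ℤₚ.∣i+j∣≤∣i∣+∣j∣ (D i (k′ + (i + t))) (D i (i + t))) ⟩
        (∣ D i (k′ + (i + t)) ∣ + ∣ D i (i + t) ∣) * q ^ i
          ≡⟨ cong (λ e → (∣ D i e ∣ + ∣ D i (i + t) ∣) * q ^ i) (left-comm i k′ t) ⟨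
        (∣ D i (i + (k′ + t)) ∣ + ∣ D i (i + t) ∣) * q ^ i
          ≡⟨ *-distribʳ-+ (q ^ i) ∣ D i (i + (k′ + t)) ∣ _ ⟩
        ∣ D i (i + (k′ + t)) ∣ * q ^ i + ∣ D i (i + t) ∣ * q ^ i
          ≤⟨ +-mono-≤ h₂ h₁ ⟩
        K₁ * p ^ i * B (k′ + t) + K₁ * p ^ i * B t
          ≡⟨ *-distribˡ-+ (K₁ * p ^ i) (B (k′ + t)) (B t) ⟨
        K₁ * p ^ i * (B (k′ + t) + B t)
          ≡⟨ cong (K₁ * p ^ i *_) (B-rec t) ⟨
        K₁ * p ^ i * B (k + t) ∎
        where open ≤-Reasoning

    B-growth : ∀ i → g ^ i ≤ K₂ * h ^ i * B i
    B-growth = B-induction _ near far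
      where
      near : ∀ {i} → i ≤ k′ → g ^ i ≤ K₂ * h ^ i * B i
      near {i} i≤k′ rewrite B-init i≤k′ | *-identityʳ (K₂ * h ^ i) = growth-init i≤k′
      far : ∀ i → g ^ i ≤ K₂ * h ^ i * B i → g ^ (k′ + i) ≤ K₂ * h ^ (k′ + i) * B (k′ + i) →
            g ^ (k + i) ≤ K₂ * h ^ (k + i) * B (k + i)
      far i h₁ h₂ = begin
        g ^ (k + i)
          ≡⟨ ^-distribˡ-+-* g k i ⟩
        g ^ k * g ^ i
          ≤⟨ *-monoˡ-≤ (g ^ i) growth ⟩
        (h * g ^ k′ + h ^ k) * g ^ i
          ≡⟨ expand h (g ^ k′) (h ^ k) (g ^ i) ⟩
        h * (g ^ k′ * g ^ i) + h ^ k * g ^ i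
          ≡⟨ cong (λ e → h * e + h ^ k * g ^ i) (^-distribˡ-+-* g k′ i) ⟨
        h * g ^ (k′ + i) + h ^ k * g ^ i
          ≤⟨ +-mono-≤ (*-monoʳ-≤ h h₂) (*-monoʳ-≤ (h ^ k) h₁) ⟩
        h * (K₂ * h ^ (k′ + i) * B (k′ + i)) + h ^ k * (K₂ * h ^ i * B i)
          ≡⟨ collect₁ h (h ^ k) K₂ (h ^ (k′ + i)) (h ^ i) (B (k′ + i)) (B i) ⟩
        K₂ * (h * h ^ (k′ + i)) * B (k′ + i) + K₂ * (h ^ k * h ^ i) * B i
          ≡⟨ cong (λ e → K₂ * h ^ (k + i) * B (k′ + i) + K₂ * e * B i) (^-distribˡ-+-* h k i) ⟨
        K₂ * h ^ (k + i) * B (k′ + i) + K₂ * h ^ (k + i) * B i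
          ≡⟨ *-distribˡ-+ (K₂ * h ^ (k + i)) (B (k′ + i)) (B i) ⟨
        K₂ * h ^ (k + i) * (B (k′ + i) + B i)
          ≡⟨ cong (K₂ * h ^ (k + i) *_) (B-rec i) ⟨
        K₂ * h ^ (k + i) * B (k + i) ∎
        where
        open ≤-Reasoning
        expand : ∀ h x y z → (h * x + y) * z ≡ h * (x * z) + y * z
        expand = ℕRing.solve-∀
        collect₁ : ∀ h hk c x y z w → h * (c * x * z) + hk * (c * y * w) ≡ c * (h * x) * z + c * (hk * y) * w
        collect₁ = ℕRing.solve-∀

    B-supermultiplicative : ∀ i t → B i * B t ≤ B (i + t)
    B-supermultiplicative i = B-induction _ near far
      where
      near : ∀ {t} → t ≤ k′ → B i * B t ≤ B (i + t)
      near {t} t≤k′ rewrite B-init t≤k′ | *-identityʳ (B i) = B-mono (m≤m+n i t)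
      far : ∀ t → B i * B t ≤ B (i + t) → B i * B (k′ + t) ≤ B (i + (k′ + t)) → B i * B (k + t) ≤ B (i + (k + t))
      far t h₁ h₂ = begin
        B i * B (k + t)                    ≡⟨ cong (B i *_) (B-rec t) ⟩
        B i * (B (k′ + t) + B t)           ≡⟨ *-distribˡ-+ (B i) _ _ ⟩
        B i * B (k′ + t) + B i * B t       ≤⟨ +-mono-≤ h₂ h₁ ⟩
        B (i + (k′ + t)) + B (i + t)       ≡⟨ cong (λ e → B e + B (i + t)) (left-comm i k′ t) ⟩
        B (k′ + (i + t)) + B (i + t)       ≡⟨ B-rec (i + t) ⟨
        B (k + (i + t))                    ≡⟨ cong B (left-comm i k t) ⟨
        B (i + (k + t))                    ∎
        where open ≤-Reasoning

    -- The factor `B i` brought in by the lower growth bound joins the `B t` of `minor-bound`, and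
    -- supermultiplicativity absorbs both into `B M`.
    minor-decay : ∀ {i M} → i ≤ M → ∣ D i M ∣ * u ^ i ≤ K * s ^ i * B M
    minor-decay {i} i≤M = subst (λ M → ∣ D i M ∣ * u ^ i ≤ K * s ^ i * B M) (m+[n∸m]≡n i≤M) (go _)
      where
      go : ∀ t → ∣ D i (i + t) ∣ * u ^ i ≤ K * s ^ i * B (i + t)
      go t = begin
        ∣ D i (i + t) ∣ * (q * g) ^ i
          ≡⟨ cong (∣ D i (i + t) ∣ *_) (^-distribʳ-* q g i) ⟩
        ∣ D i (i + t) ∣ * (q ^ i * g ^ i)
          ≡⟨ *-assoc ∣ D i (i + t) ∣ (q ^ i) (g ^ i) ⟨
        ∣ D i (i + t) ∣ * q ^ i * g ^ i
          ≤⟨ *-mono-≤ (minor-bound i t) (B-growth i) ⟩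
        K₁ * p ^ i * B t * (K₂ * h ^ i * B i)
          ≡⟨ rearrange K₁ (p ^ i) (B t) K₂ (h ^ i) (B i) ⟩
        K₁ * K₂ * (p ^ i * h ^ i) * (B i * B t)
          ≤⟨ *-monoʳ-≤ (K₁ * K₂ * (p ^ i * h ^ i)) (B-supermultiplicative i t) ⟩
        K₁ * K₂ * (p ^ i * h ^ i) * B (i + t)
          ≡⟨ cong (λ e → K₁ * K₂ * e * B (i + t)) (^-distribʳ-* p h i) ⟨
        K₁ * K₂ * (p * h) ^ i * B (i + t) ∎
        where
        open ≤-Reasoning
        rearrange : ∀ a b c d e f → a * b * c * (d * e * f) ≡ a * d * (b * e) * (f * c)
        rearrange = ℕRing.solve-∀

  -- Growth and decay for k = 3 and k = 4

  B₃ : ℕ → ℕ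
  B₃ (suc (suc (suc i))) = B₃ (suc (suc i)) + B₃ i
  B₃ _                   = 1

  B₄ : ℕ → ℕ
  B₄ (suc (suc (suc (suc i)))) = B₄ (suc (suc (suc i))) + B₄ i
  B₄ _                         = 1

  base₃ : Base 2
  base₃ = record
    { B = B₃ ; B-init = init ; B-rec = λ _ → refl
    ; f = F 3 ; f-zero = refl ; f-rec = F-Recurrence.F-rec 3
    ; f-base = f-base ; f-base-k = refl }
    where
    init : ∀ {i} → i ≤ 2 → B₃ i ≡ 1
    init z≤n = refl
    init (s≤s z≤n) = refl
    init (s≤s (s≤s z≤n)) = refl
    f-base : ∀ {i m} → i < 2 → m ≤ 1 → F 3 (B₃ (3 + i) + m) ≡ B₃ (2 + i) + F 3 m
    f-base (s≤s z≤n) z≤n = refl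
    f-base (s≤s z≤n) (s≤s z≤n) = refl
    f-base (s≤s (s≤s z≤n)) z≤n = refl
    f-base (s≤s (s≤s z≤n)) (s≤s z≤n) = refl

  base₄ : Base 3
  base₄ = record
    { B = B₄ ; B-init = init ; B-rec = λ _ → refl
    ; f = F 4 ; f-zero = refl ; f-rec = F-Recurrence.F-rec 4
    ; f-base = f-base ; f-base-k = refl }
    where
    init : ∀ {i} → i ≤ 3 → B₄ i ≡ 1
    init z≤n = refl
    init (s≤s z≤n) = refl
    init (s≤s (s≤s z≤n)) = refl
    init (s≤s (s≤s (s≤s z≤n))) = refl
    f-base : ∀ {i m} → i < 3 → m ≤ 1 → F 4 (B₄ (4 + i) + m) ≡ B₄ (3 + i) + F 4 m
    f-base (s≤s z≤n) z≤n = refl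
    f-base (s≤s z≤n) (s≤s z≤n) = refl
    f-base (s≤s (s≤s z≤n)) z≤n = refl
    f-base (s≤s (s≤s z≤n)) (s≤s z≤n) = refl
    f-base (s≤s (s≤s (s≤s z≤n))) z≤n = refl
    f-base (s≤s (s≤s (s≤s z≤n))) (s≤s z≤n) = refl

  powers-dominate : (x : ℕ → ℤ) (p q : ℕ) → ℕ → Bool
  powers-dominate x p q zero = true
  powers-dominate x p q (suc n) = (∣ x n ∣ * q ^ n ≤ᵇ p ^ n) ∧ powers-dominate x p q n

  powers-dominate-sound : ∀ x {p q} n → powers-dominate x p q n ≡ true → ∀ {i} → i < n → ∣ x i ∣ * q ^ i ≤ p ^ i
  powers-dominate-sound x {p} {q} (suc n) eq i<1+n with ∣ x n ∣ * q ^ n ≤ᵇ p ^ n in eqₙ | m≤n⇒m<n∨m≡n i<1+n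
  ... | true | inj₁ (s≤s i<n) = powers-dominate-sound x n eq i<n
  ... | true | inj₂ refl = decide-≤ eqₙ

  D₃ D₄ : ℕ → ℕ → ℤ
  D₃ = minor B₃
  D₄ = minor B₄

  x₃ x₄ : ℕ → ℤ
  x₃ i = D₃ i (1 + i)
  x₄ i = D₄ i (1 + i)

  x₃-coefficients x₄-coefficients : List ℤ
  x₃-coefficients = + 1 ∷ ℤ.- + 1 ∷ []
  x₄-coefficients = ℤ.- + 1 ∷ + 2 ∷ + 1 ∷ + 2 ∷ + 0 ∷ ℤ.- + 5 ∷ []

  -- The characteristic polynomial X³ + X - 1 has as roots the products of two distinct roots of X³
  -- - X² - 1.
  x₃-rec : ∀ i → x₃ (3 + i) ≡ combination x₃-coefficients x₃ i
  x₃-rec i = identity (+ B₃ i) (+ B₃ (1 + i)) (+ B₃ (2 + i))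
    where
    identity : ∀ a₀ a₁ a₂ → let a₃ = a₂ ℤ.+ a₀; a₄ = a₃ ℤ.+ a₁; a₅ = a₄ ℤ.+ a₂ in
      a₃ ℤ.* a₅ ℤ.- a₄ ℤ.* a₄
      ≡ + 1 ℤ.* (a₀ ℤ.* a₂ ℤ.- a₁ ℤ.* a₁) ℤ.+ (ℤ.- + 1 ℤ.* (a₁ ℤ.* a₃ ℤ.- a₂ ℤ.* a₂) ℤ.+ + 0)
    identity = ℤRing.solve-∀

  D₃-2 : ∀ i → D₃ i (2 + i) ≡ ℤ.- x₃ (2 + i)
  D₃-2 i = identity (+ B₃ i) (+ B₃ (1 + i)) (+ B₃ (2 + i))
    where
    identity : ∀ a b c → let a₃ = c ℤ.+ a; a₄ = a₃ ℤ.+ b in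
      a ℤ.* a₃ ℤ.- b ℤ.* c ≡ ℤ.- (c ℤ.* a₄ ℤ.- a₃ ℤ.* a₃)
    identity = ℤRing.solve-∀

  -- X¹² + 5X⁵ - 2X³ - X² - 2X + 1 is a multiple of X⁶ + X⁴ + X³ - X² - 1, whose roots are the
  -- products of two distinct roots of X⁴ - X³ - 1; its coefficients are small enough
  -- to bound the modulus of all roots by 4/3.
  x₄-rec : ∀ i → x₄ (12 + i) ≡ combination x₄-coefficients x₄ i
  x₄-rec i = identity (+ B₄ i) (+ B₄ (1 + i)) (+ B₄ (2 + i)) (+ B₄ (3 + i))
    where
    identity : ∀ a₀ a₁ a₂ a₃ → let
        a₄ = a₃ ℤ.+ a₀; a₅ = a₄ ℤ.+ a₁; a₆ = a₅ ℤ.+ a₂; a₇ = a₆ ℤ.+ a₃; a₈ = a₇ ℤ.+ a₄; a₉ = a₈ ℤ.+ a₅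
        a₁₀ = a₉ ℤ.+ a₆; a₁₁ = a₁₀ ℤ.+ a₇; a₁₂ = a₁₁ ℤ.+ a₈; a₁₃ = a₁₂ ℤ.+ a₉; a₁₄ = a₁₃ ℤ.+ a₁₀ in
      a₁₂ ℤ.* a₁₄ ℤ.- a₁₃ ℤ.* a₁₃
      ≡ ℤ.- + 1 ℤ.* (a₀ ℤ.* a₂ ℤ.- a₁ ℤ.* a₁) ℤ.+ (+ 2 ℤ.* (a₁ ℤ.* a₃ ℤ.- a₂ ℤ.* a₂)
        ℤ.+ (+ 1 ℤ.* (a₂ ℤ.* a₄ ℤ.- a₃ ℤ.* a₃) ℤ.+ (+ 2 ℤ.* (a₃ ℤ.* a₅ ℤ.- a₄ ℤ.* a₄)
        ℤ.+ (+ 0 ℤ.* (a₄ ℤ.* a₆ ℤ.- a₅ ℤ.* a₅) ℤ.+ (ℤ.- + 5 ℤ.* (a₅ ℤ.* a₇ ℤ.- a₆ ℤ.* a₆) ℤ.+ + 0)))))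
    identity = ℤRing.solve-∀

  -- Rewrites the minor at distance 2 by minors at distance 1 with nonnegative shifts, to which the
  -- decay of `x₄` applies through `delay`.
  D₄-2 : ∀ i → D₄ i (2 + i) ≡ x₄ (2 + i) ℤ.- x₄ (1 + i) ℤ.+ x₄ (5 + i)
  D₄-2 i = identity (+ B₄ i) (+ B₄ (1 + i)) (+ B₄ (2 + i)) (+ B₄ (3 + i))
    where
    identity : ∀ a₀ a₁ a₂ a₃ → let a₄ = a₃ ℤ.+ a₀; a₅ = a₄ ℤ.+ a₁; a₆ = a₅ ℤ.+ a₂; a₇ = a₆ ℤ.+ a₃ in
      a₀ ℤ.* a₃ ℤ.- a₁ ℤ.* a₂
      ≡ (a₂ ℤ.* a₄ ℤ.- a₃ ℤ.* a₃) ℤ.- (a₁ ℤ.* a₃ ℤ.- a₂ ℤ.* a₂) ℤ.+ (a₅ ℤ.* a₇ ℤ.- a₆ ℤ.* a₆)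
    identity = ℤRing.solve-∀

  D₄-3 : ∀ i → D₄ i (3 + i) ≡ ℤ.- x₄ (3 + i)
  D₄-3 i = identity (+ B₄ i) (+ B₄ (1 + i)) (+ B₄ (2 + i)) (+ B₄ (3 + i))
    where
    identity : ∀ a₀ a₁ a₂ a₃ → let a₄ = a₃ ℤ.+ a₀; a₅ = a₄ ℤ.+ a₁ in
      a₀ ℤ.* a₄ ℤ.- a₁ ℤ.* a₃ ≡ ℤ.- (a₃ ℤ.* a₅ ℤ.- a₄ ℤ.* a₄)
    identity = ℤRing.solve-∀

  D-diagonal : ∀ B i → minor B i i ≡ + 0
  D-diagonal B i = identity (+ B i) (+ B (suc i))
    where
    identity : ∀ a b → a ℤ.* b ℤ.- b ℤ.* a ≡ + 0
    identity = ℤRing.solve-∀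

  x₃-decay : ∀ i → ∣ x₃ i ∣ * 3 ^ i ≤ 4 ^ i
  -- The root bound 4/3 holds narrowly: the weight is 27 + 36 = 63 against 4^3 = 64.
  x₃-decay = geometric-decay x₃ x₃-coefficients 3 (≤ᵇ⇒≤ 2 3 tt) x₃-rec (decide-≤ refl)
    (powers-dominate-sound x₃ 3 refl)

  x₄-decay : ∀ i → ∣ x₄ i ∣ * 3 ^ i ≤ 4 ^ i
  x₄-decay = geometric-decay x₄ x₄-coefficients 12 (≤ᵇ⇒≤ 6 12 tt) x₄-rec (decide-≤ refl)
    (powers-dominate-sound x₄ 12 refl)

  delay : ∀ {x : ℕ → ℤ} l a → (∀ i → ∣ x i ∣ * 3 ^ i ≤ 4 ^ i) → 4 ^ l ≤ a * 3 ^ l →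
          ∀ i → ∣ x (l + i) ∣ * 3 ^ i ≤ a * 4 ^ i
  delay {x} l a decay small i = *-cancelʳ-≤ _ _ (3 ^ l) ⦃ m^n≢0 3 l ⦄ (begin
    ∣ x (l + i) ∣ * 3 ^ i * 3 ^ l     ≡⟨ *-assoc ∣ x (l + i) ∣ _ _ ⟩
    ∣ x (l + i) ∣ * (3 ^ i * 3 ^ l)   ≡⟨ cong (∣ x (l + i) ∣ *_) (trans (*-comm (3 ^ i) _) (sym (^-distribˡ-+-* 3 l i))) ⟩
    ∣ x (l + i) ∣ * 3 ^ (l + i)       ≤⟨ decay (l + i) ⟩
    4 ^ (l + i)                       ≡⟨ ^-distribˡ-+-* 4 l i ⟩
    4 ^ l * 4 ^ i                     ≤⟨ *-monoˡ-≤ (4 ^ i) small ⟩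
    a * 3 ^ l * 4 ^ i                 ≡⟨ swap a (3 ^ l) (4 ^ i) ⟩
    a * 4 ^ i * 3 ^ l                 ∎)
    where
    open ≤-Reasoning
    swap : ∀ a b c → a * b * c ≡ a * c * b
    swap = ℕRing.solve-∀

  diagonal-small : ∀ B K i → ∣ minor B i (i + 0) ∣ * 3 ^ i ≤ K * 4 ^ i
  diagonal-small B K i rewrite +-identityʳ i | D-diagonal B i = z≤n

  -- 19/13 and 40/29 are slightly below 1.4656 and 1.3803, the dominant roots of X³ - X² - 1 and X⁴ - X³ - 1.
  decay₃ : Decay base₃
  decay₃ = record
    { p = 4 ; q = 3 ; K₁ = 2 ; minor-near = near
    ; g = 19 ; h = 13 ; K₂ = 3 ; growth = decide-≤ refl ; growth-init = init }
    where
    near : ∀ i {t} → t ≤ 2 → ∣ D₃ i (i + t) ∣ * 3 ^ i ≤ 2 * 4 ^ i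
    near i z≤n = diagonal-small B₃ 2 i
    near i (s≤s z≤n) rewrite +-comm i 1 = ≤-trans (x₃-decay i) (m≤m+n (4 ^ i) _)
    near i (s≤s (s≤s z≤n)) rewrite +-comm i 2 | D₃-2 i | ℤₚ.∣-i∣≡∣i∣ (x₃ (2 + i)) =
      delay {x₃} 2 2 x₃-decay (decide-≤ refl) i
    init : ∀ {i} → i ≤ 2 → 19 ^ i ≤ 3 * 13 ^ i
    init z≤n = decide-≤ refl
    init (s≤s z≤n) = decide-≤ refl
    init (s≤s (s≤s z≤n)) = decide-≤ refl

  decay₄ : Decay base₄
  decay₄ = record
    -- 9 = 2 + 2 + 5, where the summands round up (4/3)^2, 4/3 and (4/3)^5 from the three terms of
    -- `D₄-2`; 3 rounds up (40/29)^3.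
    { p = 4 ; q = 3 ; K₁ = 9 ; minor-near = near
    ; g = 40 ; h = 29 ; K₂ = 3 ; growth = decide-≤ refl ; growth-init = init }
    where
    near : ∀ i {t} → t ≤ 3 → ∣ D₄ i (i + t) ∣ * 3 ^ i ≤ 9 * 4 ^ i
    near i z≤n = diagonal-small B₄ 9 i
    near i (s≤s z≤n) rewrite +-comm i 1 = ≤-trans (x₄-decay i) (m≤m+n (4 ^ i) _)
    near i (s≤s (s≤s z≤n)) rewrite +-comm i 2 | D₄-2 i = begin
      ∣ x₄ (2 + i) ℤ.- x₄ (1 + i) ℤ.+ x₄ (5 + i) ∣ * 3 ^ i
        ≤⟨ *-monoˡ-≤ (3 ^ i) (≤-trans (ℤₚ.∣i+j∣≤∣i∣+∣j∣ (x₄ (2 + i) ℤ.- x₄ (1 + i)) (x₄ (5 + i)))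
             (+-monoˡ-≤ ∣ x₄ (5 + i) ∣ (ℤₚ.∣i-j∣≤∣i∣+∣j∣ (x₄ (2 + i)) (x₄ (1 + i))))) ⟩
      (∣ x₄ (2 + i) ∣ + ∣ x₄ (1 + i) ∣ + ∣ x₄ (5 + i) ∣) * 3 ^ i
        ≡⟨ distrib (∣ x₄ (2 + i) ∣) (∣ x₄ (1 + i) ∣) (∣ x₄ (5 + i) ∣) (3 ^ i) ⟩
      ∣ x₄ (2 + i) ∣ * 3 ^ i + ∣ x₄ (1 + i) ∣ * 3 ^ i + ∣ x₄ (5 + i) ∣ * 3 ^ i
        ≤⟨ +-mono-≤ (+-mono-≤ (delay {x₄} 2 2 x₄-decay (decide-≤ refl) i)
             (delay {x₄} 1 2 x₄-decay (decide-≤ refl) i)) (delay {x₄} 5 5 x₄-decay (decide-≤ refl) i) ⟩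
      2 * 4 ^ i + 2 * 4 ^ i + 5 * 4 ^ i
        ≡⟨ collect (4 ^ i) ⟩
      9 * 4 ^ i ∎
      where
      open ≤-Reasoning
      distrib : ∀ a b c t → (a + b + c) * t ≡ a * t + b * t + c * t
      distrib = ℕRing.solve-∀
      collect : ∀ t → 2 * t + 2 * t + 5 * t ≡ 9 * t
      collect = ℕRing.solve-∀
    near i (s≤s (s≤s (s≤s z≤n))) rewrite +-comm i 3 | D₄-3 i | ℤₚ.∣-i∣≡∣i∣ (x₄ (3 + i)) =
      delay {x₄} 3 9 x₄-decay (decide-≤ refl) i
    init : ∀ {i} → i ≤ 3 → 40 ^ i ≤ 3 * 29 ^ i
    init z≤n = decide-≤ refl
    init (s≤s z≤n) = decide-≤ refl
    init (s≤s (s≤s z≤n)) = decide-≤ refl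
    init (s≤s (s≤s (s≤s z≤n))) = decide-≤ refl

  -- The dynamic program

  data Window {A : Set} (Q : ℕ → A → Set) : ℕ → ∀ {n} → Vec A n → Set where
    []  : ∀ {i} → Window Q i []
    _∷_ : ∀ {i n a} {as : Vec A n} → Q i a → Window Q (suc i) as → Window Q i (a ∷ as)

  module _ {A : Set} {Q : ℕ → A → Set} where

    Window-∷ʳ : ∀ {i n} {as : Vec A n} {a} → Window Q i as → Q (n + i) a → Window Q i (as ∷ʳ a)
    Window-∷ʳ [] q = q ∷ []
    Window-∷ʳ {i} {suc n} {_} {a} (q′ ∷ w) q = q′ ∷ Window-∷ʳ w (subst (λ j → Q j a) (sym (+-suc n i)) q)

    Window-last : ∀ {i n} {as : Vec A (suc n)} → Window Q i as → Q (n + i) (last as)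
    Window-last (q ∷ []) = q
    Window-last {i} {suc n} {_ ∷ as} (_ ∷ w@(_ ∷ _)) = subst (λ j → Q j (last as)) (+-suc n i) (Window-last w)

    Window-head : ∀ {i n} {as : Vec A (suc n)} → Window Q i as → Q i (head as)
    Window-head (q ∷ _) = q

  -- At index `i`: `prev` and `cur` are `B i` and `B (suc i)`, `arg` is a maximizer below `cur`, and
  -- `val` is `f arg`. Additivity updates `val` along with `arg`, so that `f` is never computed.
  record Entry : Set where
    constructor entry
    field prev cur arg val : ℕ
  open Entry
  value : ℤ → ℤ → ℕ → ℕ → ℤ
  value y z n m = + m ℤ.* y ℤ.- + n ℤ.* z

  choose : ℤ → ℤ → ℕ × ℕ → ℕ × ℕ → ℕ × ℕ
  choose y z (n , m) (n′ , m′) = if value y z n m ℤ.≤ᵇ value y z n′ m′ then (n′ , m′) else (n , m)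

  -- With `e` at index `i` and `e′` at `k′ + i`, the result belongs to `k + i`: a number below
  -- `B (suc (k + i))` either lies below `B (k + i)`, the range of `e′`, or is `B (k + i)` plus a
  -- number in the range of `e`.
  extend : ℤ → ℤ → Entry → Entry → Entry
  extend y z e e′ = entry (cur e′) (cur e′ + cur e) (proj₁ best) (proj₂ best)
    where best = choose y z (arg e′ , val e′) (cur e′ + arg e , prev e′ + val e)

  -- `B` is 1 up to index `k′`, so 0 is the only number available, except in the last entry, where
  -- `B k = 2` also admits 1.
  initial : ℤ → ℤ → ∀ k′ → Vec Entry (suc k′)
  initial y z zero = entry 1 2 (proj₁ best) (proj₂ best) ∷ []
    where best = choose y z (0 , 0) (1 , 1)
  initial y z (suc k′) = entry 1 1 0 0 ∷ initial y z k′

  search : ℤ → ℤ → ∀ k′ → ℕ → Vec Entry (suc k′)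
  search y z k′ zero = initial y z k′
  search y z k′ (suc i) = step (search y z k′ i)
    where
    step : Vec Entry (suc k′) → Vec Entry (suc k′)
    step w = tail w ∷ʳ extend y z (head w) (last w)

  module Optimization {k′ : ℕ} (base : Base k′) (y z : ℤ) where

    open Numeration base

    L : ℕ → ℤ
    L n = value y z n (f n)

    record Optimal (i : ℕ) (e : Entry) : Set where
      field
        prev≡   : prev e ≡ B i
        cur≡    : cur e ≡ B (suc i)
        arg<    : arg e < B (suc i)
        val≡    : val e ≡ f (arg e)
        maximal : ∀ {n} → n < B (suc i) → L n ℤ.≤ value y z (arg e) (val e)
    open Optimal

    L-additive : ∀ i {m} → m ≤ B (suc i) → L (B (k + i) + m) ≡ value y z (B (k + i)) (B (k′ + i)) ℤ.+ L m
    L-additive i {m} m≤ rewrite f-additive i m≤ =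
      trans (cong₂ (λ a c → a ℤ.* y ℤ.- c ℤ.* z) (ℤₚ.pos-+ (B (k′ + i)) (f m)) (ℤₚ.pos-+ (B (k + i)) m))
        (distrib (+ B (k′ + i)) (+ f m) (+ B (k + i)) (+ m) y z)
      where
      distrib : ∀ a a′ c c′ y z → (a ℤ.+ a′) ℤ.* y ℤ.- (c ℤ.+ c′) ℤ.* z ≡ (a ℤ.* y ℤ.- c ℤ.* z) ℤ.+ (a′ ℤ.* y ℤ.- c′ ℤ.* z)
      distrib = ℤRing.solve-∀

    Choice : ℕ → ℤ → ℤ → ℕ × ℕ → Set
    Choice j l l′ (n , m) = n < j × m ≡ f n × l ℤ.≤ value y z n m × l′ ℤ.≤ value y z n m

    choose-sound : ∀ {j n m n′ m′} → n < j → m ≡ f n → n′ < j → m′ ≡ f n′ →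
                   Choice j (value y z n m) (value y z n′ m′) (choose y z (n , m) (n′ , m′))
    choose-sound {j} {n} {m} {n′} {m′} n< m≡ n′< m′≡ with value y z n m ℤ.≤ᵇ value y z n′ m′ in eq
    ... | true  = n′< , m′≡ , ℤₚ.≤ᵇ⇒≤ (subst T (sym eq) tt) , ℤₚ.≤-refl
    ... | false = n< , m≡ , ℤₚ.≤-refl , ℤₚ.<⇒≤ (ℤₚ.≰⇒> λ le → subst T eq (ℤₚ.≤⇒≤ᵇ le))

    B-suc : ∀ i → B (suc (k + i)) ≡ B (k + i) + B (suc i)
    B-suc i = trans (cong B (sym (+-suc k i))) (trans (B-rec (suc i)) (cong (λ e → B e + B (suc i)) (+-suc k′ i)))

    split-below : ∀ i {n} → n < B (suc (k + i)) → n < B (k + i) ⊎ ∃ λ m → m < B (suc i) × n ≡ B (k + i) + m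
    split-below i {n} n< with ≤-<-connex (B (k + i)) n
    ... | inj₂ n<B = inj₁ n<B
    ... | inj₁ B≤n with n ∸ B (k + i) | m+[n∸m]≡n B≤n
    ...   | m | refl = inj₂ (m , +-cancelˡ-< (B (k + i)) _ _ (subst (B (k + i) + m <_) (B-suc i) n<) , refl)

    extend-optimal : ∀ {i e e′} → Optimal i e → Optimal (k′ + i) e′ → Optimal (k + i) (extend y z e e′)
    extend-optimal {i} {e} {e′} o o′ = record
      { prev≡   = cur≡ o′
      ; cur≡    = trans (cong₂ _+_ (cur≡ o′) (cur≡ o)) (sym (B-suc i))
      ; arg<    = proj₁ chosen
      ; val≡    = proj₁ (proj₂ chosen)
      ; maximal = maximal′ }
      where
      candidate = cur e′ + arg e
      candidate-val = prev e′ + val e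
      candidate≡ : candidate ≡ B (k + i) + arg e
      candidate≡ = cong (_+ arg e) (cur≡ o′)
      candidate-val≡ : candidate-val ≡ B (k′ + i) + val e
      candidate-val≡ = cong (_+ val e) (prev≡ o′)
      chosen : Choice (B (suc (k + i))) (value y z (arg e′) (val e′)) (value y z candidate candidate-val)
                      (choose y z (arg e′ , val e′) (candidate , candidate-val))
      chosen = choose-sound
        (<-≤-trans (arg< o′) (B-step (k + i))) (val≡ o′)
        (subst₂ _<_ (sym candidate≡) (sym (B-suc i)) (+-monoʳ-< (B (k + i)) (arg< o)))
        (trans candidate-val≡ (trans (cong (λ v → B (k′ + i) + v) (val≡ o))
          (trans (sym (f-additive i (<⇒≤ (arg< o)))) (cong f (sym candidate≡)))))
      candidate-value : value y z candidate candidate-val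
                        ≡ value y z (B (k + i)) (B (k′ + i)) ℤ.+ value y z (arg e) (val e)
      candidate-value = begin
        value y z candidate candidate-val
          ≡⟨ cong₂ (value y z) candidate≡ candidate-val≡ ⟩
        value y z (B (k + i) + arg e) (B (k′ + i) + val e)
          ≡⟨ cong (λ v → value y z (B (k + i) + arg e) (B (k′ + i) + v)) (val≡ o) ⟩
        value y z (B (k + i) + arg e) (B (k′ + i) + f (arg e))
          ≡⟨ cong (value y z (B (k + i) + arg e)) (f-additive i (<⇒≤ (arg< o))) ⟨
        L (B (k + i) + arg e)
          ≡⟨ L-additive i (<⇒≤ (arg< o)) ⟩
        value y z (B (k + i)) (B (k′ + i)) ℤ.+ L (arg e)
          ≡⟨ cong (λ v → value y z (B (k + i)) (B (k′ + i)) ℤ.+ value y z (arg e) v) (val≡ o) ⟨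
        value y z (B (k + i)) (B (k′ + i)) ℤ.+ value y z (arg e) (val e) ∎
        where open ≡-Reasoning
      best = choose y z (arg e′ , val e′) (candidate , candidate-val)
      maximal′ : ∀ {n} → n < B (suc (k + i)) → L n ℤ.≤ value y z (proj₁ best) (proj₂ best)
      maximal′ n< with split-below i n<
      ... | inj₁ n<B = ℤₚ.≤-trans (maximal o′ n<B) (proj₁ (proj₂ (proj₂ chosen)))
      ... | inj₂ (m , m< , refl) = begin
        L (B (k + i) + m)
          ≡⟨ L-additive i (<⇒≤ m<) ⟩
        value y z (B (k + i)) (B (k′ + i)) ℤ.+ L m
          ≤⟨ ℤₚ.+-monoʳ-≤ (value y z (B (k + i)) (B (k′ + i))) (maximal o m<) ⟩
        value y z (B (k + i)) (B (k′ + i)) ℤ.+ value y z (arg e) (val e)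
          ≡⟨ candidate-value ⟨
        value y z candidate candidate-val
          ≤⟨ proj₂ (proj₂ (proj₂ chosen)) ⟩
        value y z (proj₁ best) (proj₂ best) ∎
        where open ℤₚ.≤-Reasoning

    f-one : f 1 ≡ 1
    f-one = begin
      f 1                   ≡⟨ +-identityʳ (f 1) ⟨
      f 1 + 0               ≡⟨ cong (λ v → f 1 + v) (n≤0⇒n≡0 (iter-f≤ k 0)) ⟨
      f 1 + iter k f 0      ≡⟨ f-rec 0 ⟩
      1                     ∎
      where open ≡-Reasoning

    B-k : B k ≡ 2
    B-k = begin
      B k              ≡⟨ cong B (+-identityʳ k) ⟨
      B (k + 0)        ≡⟨ B-rec 0 ⟩
      B (k′ + 0) + B 0 ≡⟨ cong₂ _+_ (B-init (≤-reflexive (+-identityʳ k′))) (B-init z≤n) ⟩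
      2                ∎
      where open ≡-Reasoning

    initial-optimal : ∀ r i → r + i ≡ k′ → Window Optimal i (initial y z r)
    initial-optimal zero i refl = record
      { prev≡ = sym (B-init ≤-refl) ; cur≡ = sym B-k
      ; arg<  = subst (_ <_) (sym B-k) (proj₁ chosen) ; val≡ = proj₁ (proj₂ chosen)
      ; maximal = λ {n} n< → maximal′ n (subst (n <_) B-k n<) } ∷ []
      where
      chosen : Choice 2 (value y z 0 0) (value y z 1 1) (choose y z (0 , 0) (1 , 1))
      chosen = choose-sound (s≤s z≤n) (sym f-zero) (s≤s (s≤s z≤n)) (sym f-one)
      best = choose y z (0 , 0) (1 , 1)
      maximal′ : ∀ n → n < 2 → L n ℤ.≤ value y z (proj₁ best) (proj₂ best)
      maximal′ zero _ rewrite f-zero = proj₁ (proj₂ (proj₂ chosen))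
      maximal′ (suc zero) _ rewrite f-one = proj₂ (proj₂ (proj₂ chosen))
      maximal′ (suc (suc n)) (s≤s (s≤s ()))
    initial-optimal (suc r) i eq = record
      { prev≡ = sym (B-init (<⇒≤ i<k′)) ; cur≡ = sym (B-init i<k′)
      ; arg< = B>0 (suc i) ; val≡ = sym f-zero
      ; maximal = λ {n} n< → ℤₚ.≤-reflexive (zero-case n (subst (n <_) (B-init i<k′) n<)) }
      ∷ initial-optimal r (suc i) (trans (+-suc r i) eq)
      where
      i<k′ : suc i ≤ k′
      i<k′ = subst (suc i ≤_) eq (s≤s (m≤n+m i r))
      zero-case : ∀ n → n < 1 → L n ≡ value y z 0 0
      zero-case zero _ = cong (value y z 0) f-zero
      zero-case (suc n) (s≤s ())

    search-window : ∀ i → Window Optimal i (search y z k′ i)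
    search-window zero = initial-optimal k′ 0 (+-identityʳ k′)
    search-window (suc i) with search y z k′ i | search-window i
    ... | w@(e ∷ _) | ok@(o ∷ os) = Window-∷ʳ os
      (subst (λ j → Optimal j (extend y z e (last w))) (sym (+-suc k′ i)) (extend-optimal o (Window-last ok)))

    search-optimal : ∀ i → Optimal i (head (search y z k′ i))
    search-optimal i = Window-head (search-window i)

  -- Integer bounds for the scaled deviation

  0≤+ : ∀ {a b} → + 0 ℤ.≤ a → + 0 ℤ.≤ b → + 0 ℤ.≤ a ℤ.+ b
  0≤+ = ℤₚ.+-mono-≤

  0≤* : ∀ {a b} → + 0 ℤ.≤ a → + 0 ℤ.≤ b → + 0 ℤ.≤ a ℤ.* b
  0≤* {+ m} {+ n} _ _ = subst (+ 0 ℤ.≤_) (ℤₚ.pos-* m n) (+≤+ z≤n)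

  0≤pos : ∀ {n} → + 0 ℤ.≤ + n
  0≤pos = +≤+ z≤n

  ≤∣∣ : ∀ i → i ℤ.≤ + ∣ i ∣
  ≤∣∣ (+ n) = ℤₚ.≤-refl
  ≤∣∣ -[1+ n ] = -≤+

  -- The n below B (k + J′) whose deviation, times σ, is largest when α is replaced by B M / B (M + 1).
  champion : (k′ J′ : ℕ) (σ : ℤ) → ℕ → Entry
  champion k′ J′ σ M = head (search (σ ℤ.* + cur e) (σ ℤ.* + prev e) k′ (k′ + J′))
    -- With zero objective the search serves as a linear-time table of `B`: `prev e` and `cur e` are
    -- `B M` and `B (suc M)`.
    where e = head (search (+ 0) (+ 0) k′ M)

  champion-val : ∀ {k′} (base : Base k′) J′ σ M →
                 val (champion k′ J′ σ M) ≡ Base.f base (arg (champion k′ J′ σ M))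
  champion-val {k′} base J′ σ M = Optimal.val≡ (search-optimal (k′ + J′))
    where
    e = head (search (+ 0) (+ 0) k′ M)
    open Optimization base (σ ℤ.* + cur e) (σ ℤ.* + prev e)

  -- σ = 1 bounds δ above by c / S, σ = -1 bounds it below by - c / S. The cutoff J is k + J′, and
  -- H (s / u)^j B (M + 1) is the reserve kept for the digits from j on.
  module Extremum {k′ : ℕ} {base : Base k′} (decay : Decay base)
                  (σ : ℤ) (σ≤1 : ∣ σ ∣ ≤ 1) (S c H J′ : ℕ) where

    open Numeration base
    open DecayProperties decay

    J : ℕ
    J = k + J′

    deviation : ℕ → ℕ → ℤ
    deviation M n = value (σ ℤ.* b (suc M)) (σ ℤ.* b M) n (f n)

    -- For positive `U`, nonnegativity means S Z ≤ (c - H V / U) b′, with the denominator cleared.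
    slack : (U V Z b′ : ℤ) → ℤ
    slack U V Z b′ = U ℤ.* + c ℤ.* b′ ℤ.- U ℤ.* + S ℤ.* Z ℤ.- V ℤ.* + H ℤ.* b′

    Slack : ℕ → Set
    Slack j = ∀ n M → n < B j → j ≤ M → + 0 ℤ.≤ slack (+ (u ^ j)) (+ (s ^ j)) (deviation M n) (b (suc M))

    base-test : ℕ → Bool
    base-test M = + 0 ℤ.≤ᵇ slack (+ (u ^ J)) (+ (s ^ J))
      (value (σ ℤ.* + cur e) (σ ℤ.* + prev e) (arg m) (val m)) (+ cur e)
      where
      e = head (search (+ 0) (+ 0) k′ M)
      m = champion k′ J′ σ M

    base-tests : ℕ → Bool
    base-tests zero = true
    base-tests (suc t) = base-test (J + t) ∧ base-tests t

    base-tests-sound : ∀ r → base-tests r ≡ true → ∀ {t} → t < r → base-test (J + t) ≡ true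
    base-tests-sound (suc r) eq t<1+r with base-test (J + r) in eqᵣ | m≤n⇒m<n∨m≡n t<1+r
    ... | true | inj₁ (s≤s t<r) = base-tests-sound r eq t<r
    ... | true | inj₂ refl = eqᵣ

    module _ (tests : base-tests k ≡ true) (H-large : u * u * S * K + s * s * H ≤ u * s * H) (u>0 : 0 < u) where

      -- The slack decreases in the deviation, so the test at the champion settles every `n` below
      -- `B J`.
      base-slack-near : ∀ {t} → t ≤ k′ → ∀ {n} → n < B J →
        + 0 ℤ.≤ slack (+ (u ^ J)) (+ (s ^ J)) (deviation (J + t) n) (b (suc (J + t)))
      base-slack-near {t} t≤k′ {n} n< = subst (+ 0 ℤ.≤_) (regroup U (+ S) (+ c) V (+ H) Zₘ Z b′)
        (0≤+ tested (0≤* (0≤* {U} {+ S} 0≤pos 0≤pos) (ℤₚ.i≤j⇒0≤j-i (Optimal.maximal m-optimal n<))))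
        where
        M = J + t
        e = head (search (+ 0) (+ 0) k′ M)
        module O₀ = Optimization base (+ 0) (+ 0)
        e-optimal = O₀.search-optimal M
        prev≡ = O₀.Optimal.prev≡ e-optimal
        cur≡ = O₀.Optimal.cur≡ e-optimal
        U = + (u ^ J)
        V = + (s ^ J)
        b′ = b (suc M)
        open Optimization base (σ ℤ.* b (suc M)) (σ ℤ.* b M)
        m = head (search (σ ℤ.* b (suc M)) (σ ℤ.* b M) k′ (k′ + J′))
        m-optimal : Optimal (k′ + J′) m
        m-optimal = search-optimal (k′ + J′)
        Z = L n
        Zₘ = value (σ ℤ.* b (suc M)) (σ ℤ.* b M) (arg m) (val m)
        tested : + 0 ℤ.≤ slack U V Zₘ b′
        tested = subst₂ (λ x y → + 0 ℤ.≤ slack U V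
            (let m = head (search (σ ℤ.* + x) (σ ℤ.* + y) k′ (k′ + J′)) in value (σ ℤ.* + x) (σ ℤ.* + y) (arg m) (val m)) (+ x))
          cur≡ prev≡ (ℤₚ.≤ᵇ⇒≤ (subst T (sym (base-tests-sound k tests (s≤s t≤k′))) tt))
        regroup : ∀ U S c V H Zₘ Z b′ → (U ℤ.* c ℤ.* b′ ℤ.- U ℤ.* S ℤ.* Zₘ ℤ.- V ℤ.* H ℤ.* b′) ℤ.+ U ℤ.* S ℤ.* (Zₘ ℤ.- Z)
                  ≡ U ℤ.* c ℤ.* b′ ℤ.- U ℤ.* S ℤ.* Z ℤ.- V ℤ.* H ℤ.* b′
        regroup = ℤRing.solve-∀

      base-slack : Slack J
      base-slack n M n< J≤M = subst Q (m+[n∸m]≡n J≤M) (B-induction (λ t → Q (J + t)) (λ t≤k′ → base-slack-near t≤k′ n<) far (M ∸ J))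
        where
        U = + (u ^ J)
        V = + (s ^ J)
        Q : ℕ → Set
        Q M = + 0 ℤ.≤ slack U V (deviation M n) (b (suc M))
        far : ∀ t → Q (J + t) → Q (J + (k′ + t)) → Q (J + (k + t))
        far t q₁ q₂ = subst (λ M → Q M) (sym (left-comm J k t)) (subst (+ 0 ℤ.≤_) (sym eq) (0≤+ q₂ q₁))
          where
          linear : ∀ U S c V H σ m n x₁ x₂ y₁ y₂ →
            U ℤ.* c ℤ.* (y₂ ℤ.+ y₁) ℤ.- U ℤ.* S ℤ.* (m ℤ.* (σ ℤ.* (y₂ ℤ.+ y₁)) ℤ.- n ℤ.* (σ ℤ.* (x₂ ℤ.+ x₁))) ℤ.- V ℤ.* H ℤ.* (y₂ ℤ.+ y₁)
            ≡ (U ℤ.* c ℤ.* y₂ ℤ.- U ℤ.* S ℤ.* (m ℤ.* (σ ℤ.* y₂) ℤ.- n ℤ.* (σ ℤ.* x₂)) ℤ.- V ℤ.* H ℤ.* y₂)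
              ℤ.+ (U ℤ.* c ℤ.* y₁ ℤ.- U ℤ.* S ℤ.* (m ℤ.* (σ ℤ.* y₁) ℤ.- n ℤ.* (σ ℤ.* x₁)) ℤ.- V ℤ.* H ℤ.* y₁)
          linear = ℤRing.solve-∀
          E : ℤ → ℤ → ℤ
          E x y = slack U V (value (σ ℤ.* y) (σ ℤ.* x) n (f n)) y
          eq : E (b (k + (J + t))) (b (suc (k + (J + t))))
               ≡ E (b (J + (k′ + t))) (b (suc (J + (k′ + t)))) ℤ.+ E (b (J + t)) (b (suc (J + t)))
          eq = trans (cong₂ E (b-rec (J + t)) (b-rec-suc (J + t)))
            (trans (cong (λ M → E (b M ℤ.+ b (J + t)) (b (suc M) ℤ.+ b (suc (J + t)))) (sym (left-comm J k′ t)))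
              (linear U (+ S) (+ c) V (+ H) σ (+ f n) (+ n) (b (J + t)) (b (J + (k′ + t))) (b (suc (J + t))) (b (suc (J + (k′ + t))))))

      -- Put ρ = s / u and j = k + l. The new digit `B j` adds at most S K ρ^(j-1) B (M+1) to the
      -- left side, while the reserve falls from H ρ^j to H ρ^(j+1). Divided by u², `H-large` says S
      -- K ≤ H (ρ - ρ²): the released reserve pays for the digit.
      slack-step : ∀ l → Slack (k + l) → Slack (suc (k + l))
      slack-step l IH n M n< j<M = helper (split-below l n<)
        where
        open Optimization base (σ ℤ.* b (suc M)) (σ ℤ.* b M) using (split-below; L-additive)
        j = k + l
        i = k′ + l
        j≤M = <⇒≤ j<M
        b′ = b (suc M)
        U = + (u ^ i)
        V = + (s ^ i)
        d = D i M
        Unfold : ℕ → Set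
        Unfold m = + 0 ℤ.≤ slack (+ u ℤ.* U) (+ s ℤ.* V) (deviation M m) b′
        IH′ : ∀ {m} → m < B j → Unfold m
        IH′ {m} m< = subst₂ (λ x y → + 0 ℤ.≤ slack x y (deviation M m) b′)
          (ℤₚ.pos-* u (u ^ i)) (ℤₚ.pos-* s (s ^ i)) (IH m M m< j≤M)
        fold : ∀ {m} → + 0 ℤ.≤ slack (+ u ℤ.* (+ u ℤ.* U)) (+ s ℤ.* (+ s ℤ.* V)) (deviation M m) b′ →
               + 0 ℤ.≤ slack (+ (u ^ suc j)) (+ (s ^ suc j)) (deviation M m) b′
        fold {m} = subst₂ (λ x y → + 0 ℤ.≤ slack x y (deviation M m) b′)
          (sym (trans (ℤₚ.pos-* u (u ^ j)) (cong (+ u ℤ.*_) (ℤₚ.pos-* u (u ^ i)))))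
          (sym (trans (ℤₚ.pos-* s (s ^ j)) (cong (+ s ℤ.*_) (ℤₚ.pos-* s (s ^ i)))))
        large : + 0 ℤ.≤ + u ℤ.* + s ℤ.* + H ℤ.- (+ u ℤ.* + u ℤ.* + S ℤ.* + K ℤ.+ + s ℤ.* + s ℤ.* + H)
        large = ℤₚ.i≤j⇒0≤j-i (subst₂ ℤ._≤_
          (trans (ℤₚ.pos-+ (u * u * S * K) (s * s * H)) (cong₂ ℤ._+_
            (trans (ℤₚ.pos-* (u * u * S) K) (cong (ℤ._* + K) (cast₃ u u S))) (cast₃ s s H)))
          (cast₃ u s H) (+≤+ H-large))
          where
          cast₃ : ∀ a b c → + (a * b * c) ≡ + a ℤ.* + b ℤ.* + c
          cast₃ a b c = trans (ℤₚ.pos-* (a * b) c) (cong (ℤ._* + c) (ℤₚ.pos-* a b))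
        digit-natural : ∣ σ ℤ.* d ℤ.* U ∣ ≤ K * s ^ i * B (suc M)
        digit-natural = begin
          ∣ σ ℤ.* d ℤ.* U ∣          ≡⟨ trans (ℤₚ.abs-* (σ ℤ.* d) U) (cong (_* u ^ i) (ℤₚ.abs-* σ d)) ⟩
          ∣ σ ∣ * ∣ d ∣ * u ^ i      ≤⟨ *-monoˡ-≤ (u ^ i) (*-monoˡ-≤ (∣ d ∣) σ≤1) ⟩
          1 * ∣ d ∣ * u ^ i          ≡⟨ cong (_* u ^ i) (*-identityˡ (∣ d ∣)) ⟩
          ∣ d ∣ * u ^ i              ≤⟨ minor-decay (<⇒≤ j≤M) ⟩
          K * s ^ i * B M            ≤⟨ *-monoʳ-≤ (K * s ^ i) (B-step M) ⟩
          K * s ^ i * B (suc M)      ∎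
          where open ≤-Reasoning
        digit : + 0 ℤ.≤ + K ℤ.* V ℤ.* b′ ℤ.- σ ℤ.* d ℤ.* U
        digit = ℤₚ.i≤j⇒0≤j-i (begin
          σ ℤ.* d ℤ.* U             ≤⟨ ≤∣∣ (σ ℤ.* d ℤ.* U) ⟩
          + (∣ σ ℤ.* d ℤ.* U ∣)     ≤⟨ +≤+ digit-natural ⟩
          + (K * s ^ i * B (suc M)) ≡⟨ trans (ℤₚ.pos-* (K * s ^ i) (B (suc M))) (cong (ℤ._* b′) (ℤₚ.pos-* K (s ^ i))) ⟩
          + K ℤ.* V ℤ.* b′          ∎)
          where open ℤₚ.≤-Reasoning
        helper : n < B (k + l) ⊎ (∃ λ m → m < B (suc l) × n ≡ B (k + l) + m) →
                 + 0 ℤ.≤ slack (+ (u ^ suc j)) (+ (s ^ suc j)) (deviation M n) b′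
        -- Without a new digit the reserve merely shrinks; adding `u u S K` back to `large` leaves u
        -- s H - s² H ≥ 0.
        helper (inj₁ n<Bj) = fold {n} (subst (+ 0 ℤ.≤_)
          (regroup (+ u) (+ s) U V (+ S) (+ c) (+ H) (+ K) (deviation M n) b′)
          (0≤+ (0≤* {+ u} 0≤pos (IH′ n<Bj)) (0≤* (0≤* {V} {b′} 0≤pos 0≤pos)
            (0≤+ large (0≤* (0≤* (0≤* {+ u} {+ u} 0≤pos 0≤pos) (0≤pos {S})) (0≤pos {K}))))))
          where
          regroup : ∀ u s U V S c H K Z b′ →
            u ℤ.* (u ℤ.* U ℤ.* c ℤ.* b′ ℤ.- u ℤ.* U ℤ.* S ℤ.* Z ℤ.- s ℤ.* V ℤ.* H ℤ.* b′)
            ℤ.+ V ℤ.* b′ ℤ.* (u ℤ.* s ℤ.* H ℤ.- (u ℤ.* u ℤ.* S ℤ.* K ℤ.+ s ℤ.* s ℤ.* H) ℤ.+ u ℤ.* u ℤ.* S ℤ.* K)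
            ≡ (u ℤ.* (u ℤ.* U)) ℤ.* c ℤ.* b′ ℤ.- (u ℤ.* (u ℤ.* U)) ℤ.* S ℤ.* Z ℤ.- (s ℤ.* (s ℤ.* V)) ℤ.* H ℤ.* b′
          regroup = ℤRing.solve-∀
        helper (inj₂ (m , m< , refl)) = fold {B j + m} (subst (λ Z → + 0 ℤ.≤ slack (+ u ℤ.* (+ u ℤ.* U)) (+ s ℤ.* (+ s ℤ.* V)) Z b′)
          (sym Z≡)
          (subst (+ 0 ℤ.≤_)
            (regroup (+ u) (+ s) U V (+ S) (+ c) (+ H) (+ K) (deviation M m) (σ ℤ.* d) b′)
            (0≤+ (0≤+ (0≤* {+ u} 0≤pos (IH′ m<Bj)) (0≤* (0≤* (0≤* {+ u} {+ u} 0≤pos 0≤pos) (0≤pos {S})) digit))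
              (0≤* (0≤* {V} {b′} 0≤pos 0≤pos) large))))
          where
          m<Bj : m < B j
          m<Bj = <-≤-trans m< (B-mono (s≤s (m≤n+m l k′)))
          scale : ∀ σ a b x y → a ℤ.* (σ ℤ.* y) ℤ.- b ℤ.* (σ ℤ.* x) ≡ σ ℤ.* (a ℤ.* y ℤ.- b ℤ.* x)
          scale = ℤRing.solve-∀
          Z≡ : deviation M (B j + m) ≡ σ ℤ.* d ℤ.+ deviation M m
          Z≡ = trans (L-additive l (<⇒≤ m<)) (cong (ℤ._+ deviation M m) (scale σ (b i) (b j) (b M) b′))
          regroup : ∀ u s U V S c H K Z d b′ →
            u ℤ.* (u ℤ.* U ℤ.* c ℤ.* b′ ℤ.- u ℤ.* U ℤ.* S ℤ.* Z ℤ.- s ℤ.* V ℤ.* H ℤ.* b′)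
            ℤ.+ u ℤ.* u ℤ.* S ℤ.* (K ℤ.* V ℤ.* b′ ℤ.- d ℤ.* U)
            ℤ.+ V ℤ.* b′ ℤ.* (u ℤ.* s ℤ.* H ℤ.- (u ℤ.* u ℤ.* S ℤ.* K ℤ.+ s ℤ.* s ℤ.* H))
            ≡ (u ℤ.* (u ℤ.* U)) ℤ.* c ℤ.* b′ ℤ.- (u ℤ.* (u ℤ.* U)) ℤ.* S ℤ.* (d ℤ.+ Z) ℤ.- (s ℤ.* (s ℤ.* V)) ℤ.* H ℤ.* b′
          regroup = ℤRing.solve-∀

      slack-all : ∀ t → Slack (J + t)
      slack-all zero = subst Slack (sym (+-identityʳ J)) base-slack
      slack-all (suc t) = subst Slack (trans (cong suc (sym (+-assoc k J′ t))) (sym (+-suc J t)))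
        (slack-step (J′ + t) (subst Slack (+-assoc k J′ t) (slack-all t)))

      B-unbounded : ∀ n → n < B (k + n)
      B-unbounded zero = B>0 (k + 0)
      B-unbounded (suc n) = begin-strict
        suc n                        ≤⟨ B-unbounded n ⟩
        B (k + n)                    <⟨ m<m+n (B (k + n)) (B>0 (suc n)) ⟩
        B (k + n) + B (suc n)        ≡⟨ cong (λ e → B e + B (suc n)) (+-suc k′ n) ⟨
        B (k′ + suc n) + B (suc n)   ≡⟨ B-rec (suc n) ⟨
        B (k + suc n)                ∎
        where open ≤-Reasoning

      -- Every `n` lies below some `B j`, and there the nonnegative reserve is discarded.
      deviation-bound : ∀ n → ∃ λ j → ∀ {M} → j ≤ M → + S ℤ.* deviation M n ℤ.≤ + c ℤ.* b (suc M)
      deviation-bound n = j , bound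
        where
        j = J + (k + n)
        U = u ^ j
        n< : n < B j
        n< = <-≤-trans (B-unbounded n) (B-mono (m≤n+m (k + n) J))
        bound : ∀ {M} → j ≤ M → + S ℤ.* deviation M n ℤ.≤ + c ℤ.* b (suc M)
        bound {M} j≤M = ℤₚ.*-cancelˡ-≤-pos _ _ (+ U) ⦃ ℤ.positive (ℤ.+<+ (m^n>0 u ⦃ ℕ.>-nonZero u>0 ⦄ j)) ⦄
          (ℤₚ.0≤i-j⇒j≤i (subst (+ 0 ℤ.≤_) (regroup (+ U) (+ (s ^ j)) (+ S) (+ c) (+ H) (deviation M n) (b (suc M)))
            (0≤+ (slack-all (k + n) n M n< j≤M) (0≤* (0≤* {+ (s ^ j)} {+ H} 0≤pos 0≤pos) 0≤pos))))
          where
          regroup : ∀ U V S c H Z b′ → (U ℤ.* c ℤ.* b′ ℤ.- U ℤ.* S ℤ.* Z ℤ.- V ℤ.* H ℤ.* b′) ℤ.+ V ℤ.* H ℤ.* b′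
                    ≡ U ℤ.* (c ℤ.* b′) ℤ.- U ℤ.* (S ℤ.* Z)
          regroup = ℤRing.solve-∀

  -- Rational arithmetic and the cut α

  ℚ-ring : AlmostCommutativeRing 0ℓ 0ℓ
  ℚ-ring = fromCommutativeRing ℚₚ.+-*-commutativeRing (dec⇒weaklyDec ℚₚ._≟_ 0ℚ)

  ι : ℤ → ℚ
  ι i = i ℚ./ 1

  toℚᵘ-ι : ∀ i → toℚᵘ (ι i) ≃ mkℚᵘ i 0
  toℚᵘ-ι i = ℚₚ.toℚᵘ-fromℚᵘ (mkℚᵘ i 0)

  ι-+ : ∀ i j → ι (i ℤ.+ j) ≡ ι i ℚ.+ ι j
  ι-+ i j = ℚₚ.toℚᵘ-injective (begin
    toℚᵘ (ι (i ℤ.+ j))            ≈⟨ toℚᵘ-ι (i ℤ.+ j) ⟩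
    mkℚᵘ (i ℤ.+ j) 0              ≈⟨ *≡* (cong (ℤ._* + 1) (sym (cong₂ ℤ._+_ (ℤₚ.*-identityʳ i) (ℤₚ.*-identityʳ j)))) ⟩
    mkℚᵘ i 0 ℚᵘ.+ mkℚᵘ j 0        ≈⟨ ℚᵘₚ.+-cong (toℚᵘ-ι i) (toℚᵘ-ι j) ⟨
    toℚᵘ (ι i) ℚᵘ.+ toℚᵘ (ι j)    ≈⟨ ℚₚ.toℚᵘ-homo-+ (ι i) (ι j) ⟨
    toℚᵘ (ι i ℚ.+ ι j)            ∎)
    where open ℚᵘₚ.≃-Reasoning

  ι-* : ∀ i j → ι (i ℤ.* j) ≡ ι i ℚ.* ι j
  ι-* i j = ℚₚ.toℚᵘ-injective (begin
    toℚᵘ (ι (i ℤ.* j))            ≈⟨ toℚᵘ-ι (i ℤ.* j) ⟩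
    mkℚᵘ i 0 ℚᵘ.* mkℚᵘ j 0        ≈⟨ ℚᵘₚ.*-cong (toℚᵘ-ι i) (toℚᵘ-ι j) ⟨
    toℚᵘ (ι i) ℚᵘ.* toℚᵘ (ι j)    ≈⟨ ℚₚ.toℚᵘ-homo-* (ι i) (ι j) ⟨
    toℚᵘ (ι i ℚ.* ι j)            ∎)
    where open ℚᵘₚ.≃-Reasoning

  ι-neg : ∀ i → ι (ℤ.- i) ≡ ℚ.- ι i
  ι-neg i = ℚₚ.toℚᵘ-injective (begin
    toℚᵘ (ι (ℤ.- i))      ≈⟨ toℚᵘ-ι (ℤ.- i) ⟩
    ℚᵘ.- mkℚᵘ i 0         ≈⟨ ℚᵘₚ.-‿cong (toℚᵘ-ι i) ⟨
    ℚᵘ.- toℚᵘ (ι i)       ≈⟨ ℚₚ.toℚᵘ-homo‿- (ι i) ⟨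
    toℚᵘ (ℚ.- ι i)        ∎)
    where open ℚᵘₚ.≃-Reasoning

  ι-minus : ∀ i j → ι (i ℤ.- j) ≡ ι i ℚ.- ι j
  ι-minus i j = trans (ι-+ i (ℤ.- j)) (cong (ι i ℚ.+_) (ι-neg j))

  ι-mono-≤ : ∀ {i j} → i ℤ.≤ j → ι i ℚ.≤ ι j
  ι-mono-≤ {i} {j} i≤j = ℚₚ.toℚᵘ-cancel-≤ (begin
    toℚᵘ (ι i)    ≃⟨ toℚᵘ-ι i ⟩
    mkℚᵘ i 0      ≤⟨ *≤* (ℤₚ.*-monoʳ-≤-nonNeg (+ 1) i≤j) ⟩
    mkℚᵘ j 0      ≃⟨ toℚᵘ-ι j ⟨
    toℚᵘ (ι j)    ∎)
    where open ℚᵘₚ.≤-Reasoning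

  ι-positive : ∀ {n} → 0 < n → 0ℚ ℚ.< ι (+ n)
  ι-positive {suc n} _ = ℚₚ.<-≤-trans (ℚₚ.positive⁻¹ 1ℚ) (ι-mono-≤ {+ 1} {+ suc n} (+≤+ (s≤s z≤n)))

  ι-/ : ∀ i d → ι (+ suc d) ℚ.* (i ℚ./ suc d) ≡ ι i
  ι-/ i d = ℚₚ.toℚᵘ-injective (begin
    toℚᵘ (ι (+ suc d) ℚ.* (i ℚ./ suc d))
      ≈⟨ ℚₚ.toℚᵘ-homo-* (ι (+ suc d)) (i ℚ./ suc d) ⟩
    toℚᵘ (ι (+ suc d)) ℚᵘ.* toℚᵘ (i ℚ./ suc d)
      ≈⟨ ℚᵘₚ.*-cong (toℚᵘ-ι (+ suc d)) (ℚₚ.toℚᵘ-fromℚᵘ (mkℚᵘ i d)) ⟩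
    mkℚᵘ (+ suc d) 0 ℚᵘ.* mkℚᵘ i d
      ≈⟨ *≡* (trans (ℤₚ.*-identityʳ _) (trans (ℤₚ.*-comm (+ suc d) i) (cong (λ e → i ℤ.* + suc e) (sym (+-identityʳ d))))) ⟩
    mkℚᵘ i 0
      ≈⟨ toℚᵘ-ι i ⟨
    toℚᵘ (ι i) ∎)
    where open ℚᵘₚ.≃-Reasoning

  *-monoˡ-≤ℚ : ∀ {r p q} → 0ℚ ℚ.≤ r → p ℚ.≤ q → r ℚ.* p ℚ.≤ r ℚ.* q
  *-monoˡ-≤ℚ {r} 0≤r = ℚₚ.*-monoˡ-≤-nonNeg r ⦃ ℚ.nonNegative 0≤r ⦄

  *-monoˡ-<ℚ : ∀ {r p q} → 0ℚ ℚ.< r → p ℚ.< q → r ℚ.* p ℚ.< r ℚ.* q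
  *-monoˡ-<ℚ {r} 0<r = ℚₚ.*-monoʳ-<-pos r ⦃ ℚ.positive 0<r ⦄

  *-cancelˡ-≤ℚ : ∀ {r p q} → 0ℚ ℚ.< r → r ℚ.* p ℚ.≤ r ℚ.* q → p ℚ.≤ q
  *-cancelˡ-≤ℚ {r} 0<r = ℚₚ.*-cancelˡ-≤-pos r ⦃ ℚ.positive 0<r ⦄

  0≤*ℚ : ∀ {p q} → 0ℚ ℚ.≤ p → 0ℚ ℚ.≤ q → 0ℚ ℚ.≤ p ℚ.* q
  0≤*ℚ {p} {q} 0≤p 0≤q = subst (ℚ._≤ p ℚ.* q) (ℚₚ.*-zeroʳ p) (*-monoˡ-≤ℚ 0≤p 0≤q)

  0<*ℚ : ∀ {p q} → 0ℚ ℚ.< p → 0ℚ ℚ.< q → 0ℚ ℚ.< p ℚ.* q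
  0<*ℚ {p} {q} 0<p 0<q = subst (ℚ._< p ℚ.* q) (ℚₚ.*-zeroʳ p) (*-monoˡ-<ℚ 0<p 0<q)

  ^ℚ-nonNeg : ∀ {x} j → 0ℚ ℚ.≤ x → 0ℚ ℚ.≤ x ^ℚ j
  ^ℚ-nonNeg zero 0≤x = ℚₚ.<⇒≤ (ℚₚ.positive⁻¹ 1ℚ)
  ^ℚ-nonNeg (suc j) 0≤x = 0≤*ℚ 0≤x (^ℚ-nonNeg j 0≤x)

  ^ℚ-mono : ∀ {x y} j → 0ℚ ℚ.≤ x → x ℚ.≤ y → x ^ℚ j ℚ.≤ y ^ℚ j
  ^ℚ-mono zero 0≤x x≤y = ℚₚ.≤-refl
  ^ℚ-mono {x} {y} (suc j) 0≤x x≤y = begin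
    x ℚ.* x ^ℚ j     ≤⟨ *-monoˡ-≤ℚ 0≤x (^ℚ-mono j 0≤x x≤y) ⟩
    x ℚ.* y ^ℚ j     ≡⟨ ℚₚ.*-comm x _ ⟩
    y ^ℚ j ℚ.* x     ≤⟨ *-monoˡ-≤ℚ (^ℚ-nonNeg j (ℚₚ.≤-trans 0≤x x≤y)) x≤y ⟩
    y ^ℚ j ℚ.* y     ≡⟨ ℚₚ.*-comm _ y ⟩
    y ℚ.* y ^ℚ j     ∎
    where open ℚₚ.≤-Reasoning

  P-mono-< : ∀ k {x y} → 0ℚ ℚ.≤ x → x ℚ.< y → P k x ℚ.< P k y
  P-mono-< k 0≤x x<y = ℚₚ.+-monoˡ-< (ℚ.- 1ℚ) (ℚₚ.+-mono-≤-< (^ℚ-mono k 0≤x (ℚₚ.<⇒≤ x<y)) x<y)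

  P-mono-≤ : ∀ k {x y} → 0ℚ ℚ.≤ x → x ℚ.≤ y → P k x ℚ.≤ P k y
  P-mono-≤ k 0≤x x≤y = ℚₚ.+-monoˡ-≤ (ℚ.- 1ℚ) (ℚₚ.+-mono-≤ (^ℚ-mono k 0≤x x≤y) x≤y)

  ι-^ : ∀ i j → ι (i ℤ.^ j) ≡ ι i ^ℚ j
  ι-^ i zero = refl
  ι-^ i (suc j) = trans (ι-* i (i ℤ.^ j)) (cong (ι i ℚ.*_) (ι-^ i j))

  ^ℚ-distrib-* : ∀ x y j → (x ℚ.* y) ^ℚ j ≡ x ^ℚ j ℚ.* y ^ℚ j
  ^ℚ-distrib-* x y zero = refl
  ^ℚ-distrib-* x y (suc j) = trans (cong (x ℚ.* y ℚ.*_) (^ℚ-distrib-* x y j)) (swap x y (x ^ℚ j) (y ^ℚ j))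
    where
    swap : ∀ a b c d → a ℚ.* b ℚ.* (c ℚ.* d) ≡ a ℚ.* c ℚ.* (b ℚ.* d)
    swap = ℚRing.solve-∀ ℚ-ring

  ^ℚ-pos : ∀ {x} j → 0ℚ ℚ.< x → 0ℚ ℚ.< x ^ℚ j
  ^ℚ-pos zero 0<x = ℚₚ.positive⁻¹ 1ℚ
  ^ℚ-pos (suc j) 0<x = 0<*ℚ 0<x (^ℚ-pos j 0<x)

  module Cut (k′ : ℕ) (β : ℕ → ℚ) (β>0 : ∀ M → 0ℚ ℚ.< β M)
             (β-rec : ∀ M → β (suc k′ + M) ≡ β (k′ + M) ℚ.+ β M) where

    private k = suc k′

    scaled-P : ∀ x M → β (k + M) ℚ.* P k x
               ≡ (x ^ℚ k ℚ.* β (k + M) ℚ.+ x ℚ.* β (k + M)) ℚ.- (β M ℚ.+ β (k′ + M))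
    scaled-P x M = trans (expand (β (k + M)) (x ^ℚ k) x)
      (cong (λ e → (x ^ℚ k ℚ.* β (k + M) ℚ.+ x ℚ.* β (k + M)) ℚ.- e) (trans (β-rec M) (ℚₚ.+-comm (β (k′ + M)) (β M))))
      where
      expand : ∀ b y x → b ℚ.* (y ℚ.+ x ℚ.- 1ℚ) ≡ (y ℚ.* b ℚ.+ x ℚ.* b) ℚ.- b
      expand = ℚRing.solve-∀ ℚ-ring

    shift : ∀ x y b → x ℚ.* y ℚ.* b ≡ y ℚ.* (x ℚ.* b)
    shift = ℚRing.solve-∀ ℚ-ring

    -- For positive x, chaining the hypothesis k times gives x^k β (k + j) ≤ β j, and one use gives
    -- x β (k + j) ≤ β (k′ + j). The right sides add up to β (k + j), hence x^k + x ≤ 1. `above`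
    -- reverses the inequalities.
    below : ∀ x j → (∀ {M} → j ≤ M → x ℚ.* β (suc M) ℚ.≤ β M) → x≤α k x
    below x j h with x ℚₚ.≤? 0ℚ
    ... | yes x≤0 = inj₁ x≤0
    ... | no x≰0 = inj₂ (*-cancelˡ-≤ℚ (β>0 (k + j)) (begin
      β (k + j) ℚ.* P k x
        ≡⟨ scaled-P x j ⟩
      (x ^ℚ k ℚ.* β (k + j) ℚ.+ x ℚ.* β (k + j)) ℚ.- (β j ℚ.+ β (k′ + j))
        ≤⟨ ℚₚ.+-monoˡ-≤ (ℚ.- (β j ℚ.+ β (k′ + j))) (ℚₚ.+-mono-≤ (powers k) (h (m≤n+m j k′))) ⟩
      (β j ℚ.+ β (k′ + j)) ℚ.- (β j ℚ.+ β (k′ + j))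
        ≡⟨ ℚₚ.+-inverseʳ (β j ℚ.+ β (k′ + j)) ⟩
      0ℚ
        ≡⟨ ℚₚ.*-zeroʳ (β (k + j)) ⟨
      β (k + j) ℚ.* 0ℚ ∎))
      where
      open ℚₚ.≤-Reasoning
      0≤x = ℚₚ.<⇒≤ (ℚₚ.≰⇒> x≰0)
      powers : ∀ t → x ^ℚ t ℚ.* β (t + j) ℚ.≤ β j
      powers zero = ℚₚ.≤-reflexive (ℚₚ.*-identityˡ (β j))
      powers (suc t) = begin
        x ℚ.* x ^ℚ t ℚ.* β (suc t + j)      ≡⟨ shift x (x ^ℚ t) _ ⟩
        x ^ℚ t ℚ.* (x ℚ.* β (suc t + j))    ≤⟨ *-monoˡ-≤ℚ (^ℚ-nonNeg t 0≤x) (h (m≤n+m j t)) ⟩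
        x ^ℚ t ℚ.* β (t + j)                ≤⟨ powers t ⟩
        β j                                 ∎

    above : ∀ x j → (∀ {M} → j ≤ M → β M ℚ.≤ x ℚ.* β (suc M)) → α≤x k x
    above x j h = 0<x , *-cancelˡ-≤ℚ (β>0 (k + j)) (begin
      β (k + j) ℚ.* 0ℚ
        ≡⟨ ℚₚ.*-zeroʳ (β (k + j)) ⟩
      0ℚ
        ≡⟨ ℚₚ.+-inverseʳ (β j ℚ.+ β (k′ + j)) ⟨
      (β j ℚ.+ β (k′ + j)) ℚ.- (β j ℚ.+ β (k′ + j))
        ≤⟨ ℚₚ.+-monoˡ-≤ (ℚ.- (β j ℚ.+ β (k′ + j))) (ℚₚ.+-mono-≤ (powers k) (h (m≤n+m j k′))) ⟩
      (x ^ℚ k ℚ.* β (k + j) ℚ.+ x ℚ.* β (k + j)) ℚ.- (β j ℚ.+ β (k′ + j))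
        ≡⟨ scaled-P x j ⟨
      β (k + j) ℚ.* P k x ∎)
      where
      open ℚₚ.≤-Reasoning
      0<x : 0ℚ ℚ.< x
      0<x = ℚₚ.≰⇒> λ x≤0 → ℚₚ.<-irrefl refl (ℚₚ.<-≤-trans (β>0 j) (ℚₚ.≤-trans (h ≤-refl)
        (subst₂ ℚ._≤_ (ℚₚ.*-comm (β (suc j)) x) (ℚₚ.*-zeroʳ (β (suc j))) (*-monoˡ-≤ℚ (ℚₚ.<⇒≤ (β>0 (suc j))) x≤0))))
      powers : ∀ t → β j ℚ.≤ x ^ℚ t ℚ.* β (t + j)
      powers zero = ℚₚ.≤-reflexive (sym (ℚₚ.*-identityˡ (β j)))
      powers (suc t) = begin
        β j                                 ≤⟨ powers t ⟩
        x ^ℚ t ℚ.* β (t + j)                ≤⟨ *-monoˡ-≤ℚ (^ℚ-nonNeg t (ℚₚ.<⇒≤ 0<x)) (h (m≤n+m j t)) ⟩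
        x ^ℚ t ℚ.* (x ℚ.* β (suc t + j))    ≡⟨ shift x (x ^ℚ t) _ ⟨
        x ℚ.* x ^ℚ t ℚ.* β (suc t + j)      ∎

  recip : ℕ → ℚ
  recip m = + 1 ℚ./ suc m

  recip>0 : ∀ m → 0ℚ ℚ.< recip m
  recip>0 m = ℚₚ.positive⁻¹ (recip m) ⦃ ℚₚ.normalize-pos 1 (suc m) ⦄

  recip-mono-≤ : ∀ m {p q} → p ℚ.≤ q → p ℚ.* recip m ℚ.≤ q ℚ.* recip m
  recip-mono-≤ m = ℚₚ.*-monoʳ-≤-nonNeg (recip m) ⦃ ℚ.nonNegative (ℚₚ.<⇒≤ (recip>0 m)) ⦄

  recip-mono-< : ∀ m {p q} → p ℚ.< q → p ℚ.* recip m ℚ.< q ℚ.* recip m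
  recip-mono-< m = ℚₚ.*-monoˡ-<-pos (recip m) ⦃ ℚ.positive (recip>0 m) ⦄

  ι*recip : ∀ m q → ι (+ suc m) ℚ.* (q ℚ.* recip m) ≡ q
  ι*recip m q = begin
    ι (+ suc m) ℚ.* (q ℚ.* recip m)    ≡⟨ swap (ι (+ suc m)) q (recip m) ⟩
    q ℚ.* (ι (+ suc m) ℚ.* recip m)    ≡⟨ cong (q ℚ.*_) (ι-/ (+ 1) m) ⟩
    q ℚ.* 1ℚ                           ≡⟨ ℚₚ.*-identityʳ q ⟩
    q                                  ∎
    where
    open ≡-Reasoning
    swap : ∀ a b c → a ℚ.* (b ℚ.* c) ≡ b ℚ.* (a ℚ.* c)
    swap = ℚRing.solve-∀ ℚ-ring

  cut-separates : ∀ k n {q q′} → q≤αn k n q → αn<q k n q′ → q ℚ.< q′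
  cut-separates k zero q≤ <q′ = ℚₚ.≤-<-trans q≤ <q′
  cut-separates k (suc m) {q} {q′} q≤ (0<x′ , 0<P) = ℚₚ.≰⇒> (contra q≤ ∘ recip-mono-≤ m)
    where
    contra : x≤α k (q ℚ.* recip m) → ¬ q′ ℚ.* recip m ℚ.≤ q ℚ.* recip m
    contra (inj₁ x≤0) x′≤x = ℚₚ.<-irrefl refl (ℚₚ.<-≤-trans 0<x′ (ℚₚ.≤-trans x′≤x x≤0))
    contra (inj₂ P≤0) x′≤x = ℚₚ.<-irrefl refl (ℚₚ.<-≤-trans 0<P (ℚₚ.≤-trans (P-mono-≤ k (ℚₚ.<⇒≤ 0<x′) x′≤x) P≤0))

  αn≤q-mono : ∀ k n {q q′} → q ℚ.≤ q′ → αn≤q k n q → αn≤q k n q′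
  αn≤q-mono k zero q≤q′ 0≤q = ℚₚ.≤-trans 0≤q q≤q′
  αn≤q-mono k (suc m) q≤q′ (0<x , 0≤P) =
    ℚₚ.<-≤-trans 0<x (recip-mono-≤ m q≤q′) ,
    ℚₚ.≤-trans 0≤P (P-mono-≤ k (ℚₚ.<⇒≤ 0<x) (recip-mono-≤ m q≤q′))

  -‿cancel-< : ∀ {a r d} → a ℚ.- r ℚ.< a ℚ.- d → d ℚ.≤ r
  -‿cancel-< {a} {r} {d} lt = ℚₚ.≮⇒≥ λ r<d → ℚₚ.<-asym lt (ℚₚ.+-monoʳ-< a (ℚₚ.neg-antimono-< r<d))

  -- Choosing η = b + d makes b - η = - d, so some deviation exceeds - d. An upper bound r of the
  -- deviations then satisfies - r ≤ d, and no deviation falls below d.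
  sameSup : ∀ k b d → InfGe (δ≥ k) d → SupGe (δ> k) b → 0ℚ ℚ.< b ℚ.+ d → SameSup k
  sameSup k b d inf sup 0<b+d r = to , λ h n → proj₁ (h n)
    where
    η = b ℚ.+ d
    to : SupLe (δ≤ k) r → SupLe (|δ|≤ k) r
    to h n = h n , αn≤q-mono k n (ℚₚ.+-monoʳ-≤ (ℕtoℚ (F k n)) (ℚₚ.neg-antimono-≤ -r≤d)) (inf n)
      where
      n₀ = proj₁ (sup η 0<b+d)
      -d≤r : b ℚ.- η ℚ.≤ r
      -d≤r = -‿cancel-< {ℕtoℚ (F k n₀)} (cut-separates k n₀ (h n₀) (proj₂ (sup η 0<b+d)))
      -r≤d : ℚ.- r ℚ.≤ d
      -r≤d = subst (ℚ.- r ℚ.≤_) (neg-diff b d) (ℚₚ.neg-antimono-≤ -d≤r)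
        where
        neg-diff : ∀ b d → ℚ.- (b ℚ.- (b ℚ.+ d)) ≡ d
        neg-diff = ℚRing.solve-∀ ℚ-ring

  -- From integer inequalities to the cut of α

  ι-value : ∀ y z n m → ι (value y z n m) ≡ ι (+ m) ℚ.* ι y ℚ.- ι (+ n) ℚ.* ι z
  ι-value y z n m = trans (ι-minus (+ m ℤ.* y) (+ n ℤ.* z)) (cong₂ ℚ._-_ (ι-* (+ m) y) (ι-* (+ n) z))

  module Transfer {k′ : ℕ} (base : Base k′) {S c : ℕ} (S>0 : 0 < S) where

    open Numeration base using (k; B; f; B>0; B-rec)

    β : ℕ → ℚ
    β M = ι (+ B M)

    open Cut k′ β (λ M → ι-positive (B>0 M)) (λ M → trans (cong (λ e → ι (+ e)) (B-rec M)) (ι-+ (+ B (k′ + M)) (+ B M)))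

    IntegerBound : ℤ → Set
    IntegerBound σ = ∀ n → ∃ λ j → ∀ {M} → j ≤ M →
      + S ℤ.* value (σ ℤ.* + B (suc M)) (σ ℤ.* + B M) n (f n) ℤ.≤ + c ℤ.* + B (suc M)

    rational-bound : ∀ {σ n M} → + S ℤ.* value (σ ℤ.* + B (suc M)) (σ ℤ.* + B M) n (f n) ℤ.≤ + c ℤ.* + B (suc M) →
      ι (+ S) ℚ.* (ι σ ℚ.* (ι (+ f n) ℚ.* β (suc M) ℚ.- ι (+ n) ℚ.* β M)) ℚ.≤ ι (+ c) ℚ.* β (suc M)
    rational-bound {σ} {n} {M} h = subst₂ ℚ._≤_ lhs (ι-* (+ c) (+ B (suc M))) (ι-mono-≤ h)
      where
      y = σ ℤ.* + B (suc M)
      z = σ ℤ.* + B M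
      factor : ∀ s a b x y → a ℚ.* (s ℚ.* y) ℚ.- b ℚ.* (s ℚ.* x) ≡ s ℚ.* (a ℚ.* y ℚ.- b ℚ.* x)
      factor = ℚRing.solve-∀ ℚ-ring
      lhs : ι (+ S ℤ.* value y z n (f n)) ≡ ι (+ S) ℚ.* (ι σ ℚ.* (ι (+ f n) ℚ.* β (suc M) ℚ.- ι (+ n) ℚ.* β M))
      lhs = trans (ι-* (+ S) (value y z n (f n))) (cong (ι (+ S) ℚ.*_) (trans (ι-value y z n (f n))
        (trans (cong₂ (λ p q → ι (+ f n) ℚ.* p ℚ.- ι (+ n) ℚ.* q) (ι-* σ (+ B (suc M))) (ι-* σ (+ B M)))
          (factor (ι σ) (ι (+ f n)) (ι (+ n)) (β M) (β (suc M))))))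

    cancel-S : ∀ {p q} → ι (+ S) ℚ.* p ℚ.≤ ι (+ S) ℚ.* q → p ℚ.≤ q
    cancel-S = *-cancelˡ-≤ℚ (ι-positive S>0)

    open ℚₚ.≤-Reasoning

    -- The integer bound becomes q B (M+1) ≤ n B M for all large M. Dividing by n yields the
    -- hypothesis of `below`; for n = 0 a single M already gives q ≤ 0.
    upper : ∀ {r} → ι (+ S) ℚ.* r ≡ ι (+ c) → IntegerBound (+ 1) → ∀ n → q≤αn k n (ι (+ f n) ℚ.- r)
    upper {r} Sr≡c h n with h n
    ... | j , hⱼ = go n refl
      where
      q = ι (+ f n) ℚ.- r
      linear : ∀ {M} → j ≤ M → q ℚ.* β (suc M) ℚ.≤ ι (+ n) ℚ.* β M
      linear {M} j≤M = cancel-S (begin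
        ι (+ S) ℚ.* (q ℚ.* β (suc M))
          ≡⟨ split (ι (+ S)) (ι (+ f n)) r (β (suc M)) (ι (+ n)) (β M) ⟩
        ι (+ S) ℚ.* (1ℚ ℚ.* (ι (+ f n) ℚ.* β (suc M) ℚ.- ι (+ n) ℚ.* β M)) ℚ.+ rest
          ≤⟨ ℚₚ.+-monoˡ-≤ rest (rational-bound {+ 1} {n} {M} (hⱼ j≤M)) ⟩
        ι (+ c) ℚ.* β (suc M) ℚ.+ rest
          ≡⟨ cong (λ e → e ℚ.* β (suc M) ℚ.+ rest) Sr≡c ⟨
        ι (+ S) ℚ.* r ℚ.* β (suc M) ℚ.+ rest
          ≡⟨ merge (ι (+ S)) r (β (suc M)) (ι (+ n)) (β M) ⟩
        ι (+ S) ℚ.* (ι (+ n) ℚ.* β M) ∎)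
        where
        rest = ι (+ S) ℚ.* (ι (+ n) ℚ.* β M) ℚ.- ι (+ S) ℚ.* r ℚ.* β (suc M)
        split : ∀ s a r b′ n b → s ℚ.* ((a ℚ.- r) ℚ.* b′) ≡ s ℚ.* (1ℚ ℚ.* (a ℚ.* b′ ℚ.- n ℚ.* b)) ℚ.+ (s ℚ.* (n ℚ.* b) ℚ.- s ℚ.* r ℚ.* b′)
        split = ℚRing.solve-∀ ℚ-ring
        merge : ∀ s r b′ n b → s ℚ.* r ℚ.* b′ ℚ.+ (s ℚ.* (n ℚ.* b) ℚ.- s ℚ.* r ℚ.* b′) ≡ s ℚ.* (n ℚ.* b)
        merge = ℚRing.solve-∀ ℚ-ring
      go : ∀ n′ → n ≡ n′ → q≤αn k n′ q
      go zero refl = *-cancelˡ-≤ℚ (ι-positive (B>0 (suc j))) (begin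
        β (suc j) ℚ.* q      ≡⟨ ℚₚ.*-comm (β (suc j)) q ⟩
        q ℚ.* β (suc j)      ≤⟨ linear ≤-refl ⟩
        0ℚ ℚ.* β j           ≡⟨ ℚₚ.*-zeroˡ (β j) ⟩
        0ℚ                   ≡⟨ ℚₚ.*-zeroʳ (β (suc j)) ⟨
        β (suc j) ℚ.* 0ℚ     ∎)
      go (suc m) refl = below (q ℚ.* recip m) j λ {M} j≤M → *-cancelˡ-≤ℚ (ι-positive {suc m} (s≤s z≤n)) (begin
        ι (+ suc m) ℚ.* (q ℚ.* recip m ℚ.* β (suc M))    ≡⟨ ℚₚ.*-assoc (ι (+ suc m)) (q ℚ.* recip m) (β (suc M)) ⟨
        ι (+ suc m) ℚ.* (q ℚ.* recip m) ℚ.* β (suc M)    ≡⟨ cong (ℚ._* β (suc M)) (ι*recip m q) ⟩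
        q ℚ.* β (suc M)                                  ≤⟨ linear j≤M ⟩
        ι (+ suc m) ℚ.* β M                              ∎)

    lower : ∀ {d} → ι (+ S) ℚ.* d ≡ ℚ.- ι (+ c) → IntegerBound (ℤ.- + 1) → ∀ n → αn≤q k n (ι (+ f n) ℚ.- d)
    lower {d} Sd≡-c h n with h n
    ... | j , hⱼ = go n refl
      where
      q = ι (+ f n) ℚ.- d
      linear : ∀ {M} → j ≤ M → ι (+ n) ℚ.* β M ℚ.≤ q ℚ.* β (suc M)
      linear {M} j≤M = cancel-S (begin
        ι (+ S) ℚ.* (ι (+ n) ℚ.* β M)
          ≡⟨ split (ι (+ S)) (ι (+ f n)) (β (suc M)) (ι (+ n)) (β M) ⟩
        ι (+ S) ℚ.* (ℚ.- 1ℚ ℚ.* (ι (+ f n) ℚ.* β (suc M) ℚ.- ι (+ n) ℚ.* β M)) ℚ.+ rest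
          ≤⟨ ℚₚ.+-monoˡ-≤ rest (rational-bound {ℤ.- + 1} {n} {M} (hⱼ j≤M)) ⟩
        ι (+ c) ℚ.* β (suc M) ℚ.+ rest
          ≡⟨ cong (λ e → e ℚ.* β (suc M) ℚ.+ rest) c≡ ⟩
        ℚ.- (ι (+ S) ℚ.* d) ℚ.* β (suc M) ℚ.+ rest
          ≡⟨ merge (ι (+ S)) (ι (+ f n)) d (β (suc M)) ⟩
        ι (+ S) ℚ.* (q ℚ.* β (suc M)) ∎)
        where
        rest = ι (+ S) ℚ.* (ι (+ f n) ℚ.* β (suc M))
        double-neg : ∀ a → a ≡ ℚ.- (ℚ.- a)
        double-neg = ℚRing.solve-∀ ℚ-ring
        c≡ : ι (+ c) ≡ ℚ.- (ι (+ S) ℚ.* d)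
        c≡ = trans (double-neg (ι (+ c))) (cong ℚ.-_ (sym Sd≡-c))
        split : ∀ s a b′ n b → s ℚ.* (n ℚ.* b) ≡ s ℚ.* (ℚ.- 1ℚ ℚ.* (a ℚ.* b′ ℚ.- n ℚ.* b)) ℚ.+ s ℚ.* (a ℚ.* b′)
        split = ℚRing.solve-∀ ℚ-ring
        merge : ∀ s a d b′ → ℚ.- (s ℚ.* d) ℚ.* b′ ℚ.+ s ℚ.* (a ℚ.* b′) ≡ s ℚ.* ((a ℚ.- d) ℚ.* b′)
        merge = ℚRing.solve-∀ ℚ-ring
      go : ∀ n′ → n ≡ n′ → αn≤q k n′ q
      go zero refl = *-cancelˡ-≤ℚ (ι-positive (B>0 (suc j))) (begin
        β (suc j) ℚ.* 0ℚ     ≡⟨ ℚₚ.*-zeroʳ (β (suc j)) ⟩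
        0ℚ                   ≡⟨ ℚₚ.*-zeroˡ (β j) ⟨
        0ℚ ℚ.* β j           ≤⟨ linear ≤-refl ⟩
        q ℚ.* β (suc j)      ≡⟨ ℚₚ.*-comm (β (suc j)) q ⟨
        β (suc j) ℚ.* q      ∎)
      go (suc m) refl = above (q ℚ.* recip m) j λ {M} j≤M → *-cancelˡ-≤ℚ (ι-positive {suc m} (s≤s z≤n)) (begin
        ι (+ suc m) ℚ.* β M                              ≤⟨ linear j≤M ⟩
        q ℚ.* β (suc M)                                  ≡⟨ cong (ℚ._* β (suc M)) (ι*recip m q) ⟨
        ι (+ suc m) ℚ.* (q ℚ.* recip m) ℚ.* β (suc M)    ≡⟨ ℚₚ.*-assoc (ι (+ suc m)) (q ℚ.* recip m) (β (suc M)) ⟩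
        ι (+ suc m) ℚ.* (q ℚ.* recip m ℚ.* β (suc M))    ∎)

  -- X^k + X D^(k-1) - D^k, the homogenization of P k
  homogeneous : ℕ → ℤ → ℤ → ℤ
  homogeneous k′ p d = p ℤ.^ suc k′ ℤ.+ p ℤ.* d ℤ.^ k′ ℤ.- d ℤ.^ suc k′

  homogeneous-P : ∀ k′ p d x → ι d ℚ.* x ≡ ι p → ι d ^ℚ suc k′ ℚ.* P (suc k′) x ≡ ι (homogeneous k′ p d)
  homogeneous-P k′ p d x dx≡p = begin
    ι d ^ℚ k ℚ.* (x ^ℚ k ℚ.+ x ℚ.- 1ℚ)
      ≡⟨ expand (ι d) (ι d ^ℚ k′) (x ^ℚ k) x ⟩
    ι d ^ℚ k ℚ.* x ^ℚ k ℚ.+ ι d ℚ.* x ℚ.* ι d ^ℚ k′ ℚ.- ι d ^ℚ k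
      ≡⟨ cong₂ (λ u v → u ℚ.+ v ℚ.* ι d ^ℚ k′ ℚ.- ι d ^ℚ k)
           (trans (sym (^ℚ-distrib-* (ι d) x k)) (cong (_^ℚ k) dx≡p)) dx≡p ⟩
    ι p ^ℚ k ℚ.+ ι p ℚ.* ι d ^ℚ k′ ℚ.- ι d ^ℚ k
      ≡⟨ cong₂ ℚ._-_ (trans (ι-+ (p ℤ.^ k) (p ℤ.* d ℤ.^ k′)) (cong₂ ℚ._+_ (ι-^ p k)
           (trans (ι-* p (d ℤ.^ k′)) (cong (ι p ℚ.*_) (ι-^ d k′))))) (ι-^ d k) ⟨
    ι (p ℤ.^ k ℤ.+ p ℤ.* d ℤ.^ k′) ℚ.- ι (d ℤ.^ k)
      ≡⟨ ι-minus (p ℤ.^ k ℤ.+ p ℤ.* d ℤ.^ k′) (d ℤ.^ k) ⟨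
    ι (homogeneous k′ p d) ∎
    where
    open ≡-Reasoning
    k = suc k′
    expand : ∀ d e y x → d ℚ.* e ℚ.* (y ℚ.+ x ℚ.- 1ℚ) ≡ d ℚ.* e ℚ.* y ℚ.+ d ℚ.* x ℚ.* e ℚ.- d ℚ.* e
    expand = ℚRing.solve-∀ ℚ-ring

  -- One `n` whose deviation reaches `r` suffices, since η supplies the strict inequality. Whether
  -- it does is read off from signs of integers.
  module Witness (k′ S : ℕ) (S>0 : 0 < S) (c : ℤ) {r : ℚ} (Sr≡c : ι (+ S) ℚ.* r ≡ ι c) where

    private k = suc k′

    numerator : ℕ → ℤ
    numerator m = + S ℤ.* + m ℤ.- c

    module At (n m : ℕ) where

      d = S * suc n
      p = numerator m
      x = (ι (+ m) ℚ.- r) ℚ.* recip n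

      ιd>0 : 0ℚ ℚ.< ι (+ d)
      ιd>0 = ι-positive (*-mono-≤ S>0 (s≤s z≤n))

      scaled : ι (+ d) ℚ.* x ≡ ι p
      scaled = begin
        ι (+ d) ℚ.* x
          ≡⟨ cong (ℚ._* x) (trans (cong ι (ℤₚ.pos-* S (suc n))) (ι-* (+ S) (+ suc n))) ⟩
        ι (+ S) ℚ.* ι (+ suc n) ℚ.* x
          ≡⟨ ℚₚ.*-assoc (ι (+ S)) (ι (+ suc n)) x ⟩
        ι (+ S) ℚ.* (ι (+ suc n) ℚ.* x)
          ≡⟨ cong (ι (+ S) ℚ.*_) (ι*recip n (ι (+ m) ℚ.- r)) ⟩
        ι (+ S) ℚ.* (ι (+ m) ℚ.- r)
          ≡⟨ distrib (ι (+ S)) (ι (+ m)) r ⟩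
        ι (+ S) ℚ.* ι (+ m) ℚ.- ι (+ S) ℚ.* r
          ≡⟨ cong₂ ℚ._-_ (sym (ι-* (+ S) (+ m))) Sr≡c ⟩
        ι (+ S ℤ.* + m) ℚ.- ι c
          ≡⟨ ι-minus (+ S ℤ.* + m) c ⟨
        ι p ∎
        where
        open ≡-Reasoning
        distrib : ∀ s a r → s ℚ.* (a ℚ.- r) ≡ s ℚ.* a ℚ.- s ℚ.* r
        distrib = ℚRing.solve-∀ ℚ-ring

      P-scaled : ι (+ d) ^ℚ k ℚ.* P k x ≡ ι (homogeneous k′ p (+ d))
      P-scaled = homogeneous-P k′ p (+ d) x scaled

      0≤x : + 0 ℤ.≤ p → 0ℚ ℚ.≤ x
      0≤x 0≤p = *-cancelˡ-≤ℚ ιd>0 (subst₂ ℚ._≤_ (sym (ℚₚ.*-zeroʳ (ι (+ d)))) (sym scaled) (ι-mono-≤ 0≤p))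

      0≤P : + 0 ℤ.≤ homogeneous k′ p (+ d) → 0ℚ ℚ.≤ P k x
      0≤P h = *-cancelˡ-≤ℚ (^ℚ-pos k ιd>0)
        (subst₂ ℚ._≤_ (sym (ℚₚ.*-zeroʳ (ι (+ d) ^ℚ k))) (sym P-scaled) (ι-mono-≤ h))

      P≤0 : homogeneous k′ p (+ d) ℤ.≤ + 0 → P k x ℚ.≤ 0ℚ
      P≤0 h = *-cancelˡ-≤ℚ (^ℚ-pos k ιd>0)
        (subst₂ ℚ._≤_ (sym P-scaled) (sym (ℚₚ.*-zeroʳ (ι (+ d) ^ℚ k))) (ι-mono-≤ h))

    -- `P k` is monotone on nonnegative arguments, hence the sign test on the numerator in
    -- `above-test`; on the other side a nonpositive argument lies below α outright.
    above-test below-test : ℕ → ℕ → Bool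
    above-test n m = (1 ≤ᵇ n) ∧ (+ 0 ℤ.≤ᵇ numerator m) ∧ (+ 0 ℤ.≤ᵇ homogeneous k′ (numerator m) (+ (S * n)))
    below-test n m = (1 ≤ᵇ n) ∧ (homogeneous k′ (numerator m) (+ (S * n)) ℤ.≤ᵇ + 0)

    approached-from-below : ∀ n m → F k n ≡ m → above-test n m ≡ true → SupGe (δ> k) r
    approached-from-below (suc n) m refl test η 0<η with + 0 ℤ.≤ᵇ numerator m in eq₁ | + 0 ℤ.≤ᵇ homogeneous k′ (numerator m) (+ (S * suc n)) in eq₂
    ... | true | true = suc n , ℚₚ.≤-<-trans 0≤x′ x<y , ℚₚ.≤-<-trans (0≤P (ℤₚ.≤ᵇ⇒≤ (subst T (sym eq₂) tt))) (P-mono-< k 0≤x′ x<y)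
      where
      open At n m
      0≤x′ = 0≤x (ℤₚ.≤ᵇ⇒≤ (subst T (sym eq₁) tt))
      x<y : x ℚ.< (ι (+ m) ℚ.- (r ℚ.- η)) ℚ.* recip n
      x<y = recip-mono-< n (subst₂ ℚ._<_ (ℚₚ.+-identityʳ (ι (+ m) ℚ.- r)) (regroup (ι (+ m)) r η)
        (ℚₚ.+-monoʳ-< (ι (+ m) ℚ.- r) 0<η))
        where
        regroup : ∀ a r η → (a ℚ.- r) ℚ.+ η ≡ a ℚ.- (r ℚ.- η)
        regroup = ℚRing.solve-∀ ℚ-ring

    approached-from-above : ∀ n m → F k n ≡ m → below-test n m ≡ true → InfLe (δ< k) r
    approached-from-above (suc n) m refl test η 0<η = suc n , go
      where
      open At n m
      y = (ι (+ m) ℚ.- (r ℚ.+ η)) ℚ.* recip n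
      y<x : y ℚ.< x
      y<x = recip-mono-< n (subst₂ ℚ._<_ (regroup (ι (+ m)) r η) (ℚₚ.+-identityʳ (ι (+ m) ℚ.- r))
        (ℚₚ.+-monoʳ-< (ι (+ m) ℚ.- r) (ℚₚ.neg-antimono-< 0<η)))
        where
        regroup : ∀ a r η → (a ℚ.- r) ℚ.+ (ℚ.- η) ≡ a ℚ.- (r ℚ.+ η)
        regroup = ℚRing.solve-∀ ℚ-ring
      go : x<α k y
      go with y ℚₚ.≤? 0ℚ
      ... | yes y≤0 = inj₁ y≤0
      ... | no y≰0 = inj₂ (ℚₚ.<-≤-trans (P-mono-< k (ℚₚ.<⇒≤ (ℚₚ.≰⇒> y≰0)) y<x)
                       (P≤0 (ℤₚ.≤ᵇ⇒≤ (subst T (sym test) tt))))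

  -- The numerical certificates

  module Certificate {k′ : ℕ} {base : Base k′} (decay : Decay base) (f≗F : ∀ n → Base.f base n ≡ F (suc k′) n)
                     (S H J′ : ℕ) (S>0 : 0 < S) where

    open Numeration base using (k)
    open DecayProperties decay using (u; s; K)

    module E⁺ (c : ℕ) = Extremum decay (+ 1) ≤-refl S c H J′
    module E⁻ (c : ℕ) = Extremum decay (ℤ.- + 1) ≤-refl S c H J′

    module _ (H-large : u * u * S * K + s * s * H ≤ u * s * H) (u>0 : 0 < u) where

      sup-≤ : ∀ c {r} → ι (+ S) ℚ.* r ≡ ι (+ c) → E⁺.base-tests c k ≡ true → SupLe (δ≤ k) r
      sup-≤ c {r} Sr≡c tests n = subst (λ m → q≤αn k n (ι (+ m) ℚ.- r)) (f≗F n)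
        (Transfer.upper base {S} {c} S>0 {r} Sr≡c (E⁺.deviation-bound c tests H-large u>0) n)

      inf-≥ : ∀ c {d} → ι (+ S) ℚ.* d ≡ ℚ.- ι (+ c) → E⁻.base-tests c k ≡ true → InfGe (δ≥ k) d
      inf-≥ c {d} Sd≡-c tests n = subst (λ m → αn≤q k n (ι (+ m) ℚ.- d)) (f≗F n)
        (Transfer.lower base {S} {c} S>0 {d} Sd≡-c (E⁻.deviation-bound c tests H-large u>0) n)

    -- The ratio `B J / B (J + 1)` only selects these witnesses; the tests then compare them with α
    -- itself through the sign of `P k`.
    highest lowest : Entry
    highest = champion k′ J′ (+ 1) (k + J′)
    lowest  = champion k′ J′ (ℤ.- + 1) (k + J′)

    -- Supplies the value of `F k` at a witness far too large for evaluation.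
    champion-F : ∀ σ → F k (arg (champion k′ J′ σ (k + J′))) ≡ val (champion k′ J′ σ (k + J′))
    champion-F σ = trans (sym (f≗F (arg (champion k′ J′ σ (k + J′))))) (sym (champion-val base J′ σ (k + J′)))

    sup-≥ : ∀ c {r} (Sr≡c : ι (+ S) ℚ.* r ≡ ι c) →
            Witness.above-test k′ S S>0 c Sr≡c (arg highest) (val highest) ≡ true → SupGe (δ> k) r
    sup-≥ c Sr≡c = Witness.approached-from-below k′ S S>0 c Sr≡c (arg highest) (val highest) (champion-F (+ 1))

    inf-≤ : ∀ c {r} (Sr≡c : ι (+ S) ℚ.* r ≡ ι c) →
            Witness.below-test k′ S S>0 c Sr≡c (arg lowest) (val lowest) ≡ true → InfLe (δ< k) r
    inf-≤ c Sr≡c = Witness.approached-from-above k′ S S>0 c Sr≡c (arg lowest) (val lowest) (champion-F (ℤ.- + 1))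

  -- H is chosen least with u² S K + s² H ≤ u s H.
  module C₃ = Certificate decay₃ (λ _ → refl) (10 ^ 33) 74976923076923076923076923076923077 897 (decide-≤ refl)
  module C₄ = Certificate decay₄ (λ _ → refl) (10 ^ 16) 8379310344827586207 1296 (decide-≤ refl)

  sup-≤₃ : SupLe (δ≤ 3) d3⁺
  sup-≤₃ = C₃.sup-≤ (decide-≤ refl) (decide-≤ refl) 854187179928304211983581540152668 {d3⁺} refl refl

  sup-≥₃ : SupGe (δ> 3) (d3⁺ ℚ.- ε3)
  sup-≥₃ = C₃.sup-≥ (+ 854187179928304211983581540152665) {d3⁺ ℚ.- ε3} refl refl

  inf-≥₃ : InfGe (δ≥ 3) d3⁻
  inf-≥₃ = C₃.inf-≥ (decide-≤ refl) (decide-≤ refl) 708415898743967960305146324178773 {d3⁻} refl refl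

  inf-≤₃ : InfLe (δ< 3) (d3⁻ ℚ.+ ε3)
  inf-≤₃ = C₃.inf-≤ (ℤ.- + 708415898743967960305146324178770) {d3⁻ ℚ.+ ε3} refl refl

  sup-≤₄ : SupLe (δ≤ 4) d4⁺
  sup-≤₄ = C₄.sup-≤ (decide-≤ refl) (decide-≤ refl) 15834687793247475 {d4⁺} refl refl

  sup-≥₄ : SupGe (δ> 4) (d4⁺ ℚ.- ε4)
  sup-≥₄ = C₄.sup-≥ (+ 15834687793247469) {d4⁺ ℚ.- ε4} refl refl

  inf-≥₄ : InfGe (δ≥ 4) d4⁻
  inf-≥₄ = C₄.inf-≥ (decide-≤ refl) (decide-≤ refl) 15060895457389591 {d4⁻} refl refl

  inf-≤₄ : InfLe (δ< 4) (d4⁻ ℚ.+ ε4)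
  inf-≤₄ = C₄.inf-≤ (ℤ.- + 15060895457389585) {d4⁻ ℚ.+ ε4} refl refl

  sameSup₃ : SameSup 3
  sameSup₃ = sameSup 3 (d3⁺ ℚ.- ε3) d3⁻ inf-≥₃ sup-≥₃ (toWitness {a? = 0ℚ ℚₚ.<? d3⁺ ℚ.- ε3 ℚ.+ d3⁻} tt)

  sameSup₄ : SameSup 4
  sameSup₄ = sameSup 4 (d4⁺ ℚ.- ε4) d4⁻ inf-≥₄ sup-≥₄ (toWitness {a? = 0ℚ ℚₚ.<? d4⁺ ℚ.- ε4 ℚ.+ d4⁻} tt)

  ∣δ∣-sup-≥ : ∀ k b → SupGe (δ> k) b → SupGe (|δ|> k) b
  ∣δ∣-sup-≥ k b sup η 0<η = proj₁ (sup η 0<η) , inj₁ (proj₂ (sup η 0<η))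

open import Data.Rational using (_+_; _-_)

theorem8p10 : ( SupGe (δ> 3) (d3⁺ - ε3) × SupLe (δ≤ 3) d3⁺
    × InfGe (δ≥ 3) d3⁻ × InfLe (δ< 3) (d3⁻ + ε3)
    × SupGe (δ> 4) (d4⁺ - ε4) × SupLe (δ≤ 4) d4⁺
    × InfGe (δ≥ 4) d4⁻ × InfLe (δ< 4) (d4⁻ + ε4) )
    × ( SameSup 3 × SupGe (|δ|> 3) (d3⁺ - ε3) × SupLe (|δ|≤ 3) d3⁺
    × SameSup 4 × SupGe (|δ|> 4) (d4⁺ - ε4) × SupLe (|δ|≤ 4) d4⁺ )
theorem8p10 = (sup-≥₃ , sup-≤₃ , inf-≥₃ , inf-≤₃ , sup-≥₄ , sup-≤₄ , inf-≥₄ , inf-≤₄)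
  , ( sameSup₃ , ∣δ∣-sup-≥ 3 (d3⁺ ℚ.- ε3) sup-≥₃ , proj₁ (sameSup₃ d3⁺) sup-≤₃
    , sameSup₄ , ∣δ∣-sup-≥ 4 (d4⁺ ℚ.- ε4) sup-≥₄ , proj₁ (sameSup₄ d4⁺) sup-≤₄ )
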